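{- (i) The maximum order of the autotopy group of an $n$-ary quasigroup of order $4$ equals $6\cdot 4^n$; only the linear quasigroups reach this maximum. (ii) The maximum order of the autotopy group of a nonlinear $n$-ary quasigroup of order $4$ equals $2\cdot 4^n$; only the semilinear quasigroups whose autotopy group acts transitively on their codes reach this maximum.
   Context: Let $\Sigma=\{0,1,2,3\}$. An $n$-ary quasigroup of order $4$ is a function $f:\Sigma^n\to\Sigma$ invertible in each argument. An autotopy of $f$ is a tuple $\theta=(\theta_0,\ldots,\theta_n)$ of permutations of $\Sigma$ with $f(x_1,\ldots,x_n)=\theta_0^{ -1}f(\theta_1x_1,\ldots,\theta_nx_n)$ for all $(x_1,\ldots,x_n)\in\Sigma^n$; the autotopies form, under composition, the autotopy group $\mathrm{Atp}(f)$. The code of $f$ is $M(f)=\{(x_0,x_1,\ldots,x_n)\in\Sigma^{n+1} : x_0=f(x_1,\ldots,x_n)\}$; $\mathrm{Atp}(f)$ acts on $M(f)$ by $\theta(x_0,\ldots,x_n)=(\theta_0x_0,\ldots,\theta_nx_n)$. $f$ is semilinear if there are $a_j\neq b_j$ in $\Sigma$, $j=0,1,\ldots,n$, such that $f(\{a_1,b_1\}\times\cdots\times\{a_n,b_n\})=\{a_0,b_0\}$; in this case $f$ is said to be $\{a_j,b_j\}$-semilinear in the $j$-th argument, $j=0,\ldots,n$ (the $0$-th argument is the value of $f$). $f$ is linear if, in each of its arguments $0,1,\ldots,n$, it is $\{a,b\}$-semilinear for all distinct $a,b\in\Sigma$; otherwise it is nonlinear. In (ii), the maximum and the quasigroups reaching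 it are taken among nonlinear quasigroups. -}

module Defs where

open import Algebra.Bundles using (Group)
open import Data.Fin.Base using (Fin; zero; suc)
open import Data.Fin.Permutation as Perm using (Permutation′; _⟨$⟩ʳ_; _⟨$⟩ˡ_; _∘ₚ_; inverseˡ; inverseʳ)
open import Data.Nat.Base using (ℕ; suc; _≤_)
open import Data.Product.Base using (Σ-syntax; ∃-syntax; _×_; _,_; proj₁)
open import Data.Vec.Base using (Vec; _∷_; head; tail; lookup; tabulate; _[_]≔_)
open import Data.Vec.Properties using (lookup∘tabulate; tabulate∘lookup; tabulate-cong)
open import Function.Base using (_∘_)
open import Function.Bundles using (Inverse)
open import Function.Definitions using (Bijective)
open import Level using (0ℓ)
open import Relation.Binary.PropositionalEquality using (_≡_; _≢_; refl; sym; trans; cong; setoid; module ≡-Reasoning)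
open import Relation.Nullary.Negation using (¬_)
open import Relation.Unary using (Pred; _∈_; _∪_; ｛_｝; _≐_)

Σ₄ : Set
Σ₄ = Fin 4

record Quasigroup (n : ℕ) : Set where
  field
    op         : Vec Σ₄ n → Σ₄
    invertible : ∀ (i : Fin n) (x : Vec Σ₄ n) → Bijective _≡_ _≡_ (λ a → op (x [ i ]≔ a))

open Quasigroup public

act : ∀ {k} → (Fin k → Permutation′ 4) → Vec Σ₄ k → Vec Σ₄ k
act θ x = tabulate (λ i → θ i ⟨$⟩ʳ lookup x i)

act-id : ∀ {k} (x : Vec Σ₄ k) → act (λ _ → Perm.id) x ≡ x
act-id = tabulate∘lookup

act-∘ : ∀ {k} (θ φ : Fin k → Permutation′ 4) (x : Vec Σ₄ k) →
        act (λ i → φ i ∘ₚ θ i) x ≡ act θ (act φ x)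
act-∘ θ φ x = tabulate-cong λ i →
  cong (θ i ⟨$⟩ʳ_) (sym (lookup∘tabulate (λ j → φ j ⟨$⟩ʳ lookup x j) i))

act-inverse : ∀ {k} (θ : Fin k → Permutation′ 4) (x : Vec Σ₄ k) →
              act θ (act (Perm.flip ∘ θ) x) ≡ x
act-inverse θ x = trans (sym (act-∘ θ (Perm.flip ∘ θ) x))
  (trans (tabulate-cong (λ i → inverseʳ (θ i))) (tabulate∘lookup x))

IsAutotopy : ∀ {n} → Quasigroup n → (Fin (suc n) → Permutation′ 4) → Set
IsAutotopy f θ = ∀ x → op f x ≡ θ zero ⟨$⟩ˡ op f (act (θ ∘ suc) x)

Autotopy : ∀ {n} → Quasigroup n → Set
Autotopy {n} f = Σ[ θ ∈ (Fin (suc n) → Permutation′ 4) ] IsAutotopy f θ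

-- Equality in the group is pointwise equality of the permutations.  The
-- library's π ∘ₚ ρ applies π first, so θ ∙ φ below is "φ, then θ".
Atp : ∀ {n} → Quasigroup n → Group 0ℓ 0ℓ
Atp f = record
  { Carrier = Autotopy f
  ; _≈_     = λ (θ , _) (φ , _) → ∀ j → θ j Perm.≈ φ j
  ; _∙_     = λ (θ , p) (φ , q) → (λ j → φ j ∘ₚ θ j) , ∘-closed θ φ p q
  ; ε       = (λ _ → Perm.id) , λ x → cong (op f) (sym (act-id x))
  ; _⁻¹     = λ (θ , p) → (Perm.flip ∘ θ) , flip-closed θ p
  ; isGroup = record
    { isMonoid = record
      { isSemigroup = record
        { isMagma = record
          { isEquivalence = record
            { refl  = λ _ _ → refl
            ; sym   = λ p j a → sym (p j a)
            ; trans = λ p q j a → trans (p j a) (q j a)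
            }
          ; ∙-cong = λ {(θ , _)} {(θ′ , _)} {(φ , _)} {(φ′ , _)} p q j a →
              trans (p j (φ j ⟨$⟩ʳ a)) (cong (θ′ j ⟨$⟩ʳ_) (q j a))
          }
        ; assoc = λ _ _ _ _ _ → refl
        }
      ; identity = (λ _ _ _ → refl) , (λ _ _ _ → refl)
      }
    ; inverse = (λ (θ , _) j _ → inverseˡ (θ j)) , (λ (θ , _) j _ → inverseʳ (θ j))
    ; ⁻¹-cong = λ {(θ , _)} {(φ , _)} p j a → flip-cong (θ j) (φ j) (p j) a
    }
  }
  where
  ∘-closed : ∀ θ φ → IsAutotopy f θ → IsAutotopy f φ → IsAutotopy f (λ j → φ j ∘ₚ θ j)
  ∘-closed θ φ p q x = trans (q x) (cong (φ zero ⟨$⟩ˡ_)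
    (trans (p (act (φ ∘ suc) x))
      (cong (λ y → θ zero ⟨$⟩ˡ op f y) (sym (act-∘ (θ ∘ suc) (φ ∘ suc) x)))))

  flip-closed : ∀ θ → IsAutotopy f θ → IsAutotopy f (Perm.flip ∘ θ)
  flip-closed θ p x = sym (begin
    θ zero ⟨$⟩ʳ op f x′                                     ≡⟨ cong (θ zero ⟨$⟩ʳ_) (p x′) ⟩
    θ zero ⟨$⟩ʳ (θ zero ⟨$⟩ˡ op f (act (θ ∘ suc) x′))       ≡⟨ inverseʳ (θ zero) ⟩
    op f (act (θ ∘ suc) x′)                                 ≡⟨ cong (op f) (act-inverse (θ ∘ suc) x) ⟩
    op f x                                                  ∎)
    where
    open ≡-Reasoning
    x′ = act (Perm.flip ∘ θ ∘ suc) x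

  flip-cong : (π ρ : Permutation′ 4) → π Perm.≈ ρ → Perm.flip π Perm.≈ Perm.flip ρ
  flip-cong π ρ e a = begin
    π ⟨$⟩ˡ a                     ≡⟨ cong (π ⟨$⟩ˡ_) (sym (inverseʳ ρ)) ⟩
    π ⟨$⟩ˡ (ρ ⟨$⟩ʳ (ρ ⟨$⟩ˡ a))   ≡⟨ cong (π ⟨$⟩ˡ_) (sym (e (ρ ⟨$⟩ˡ a))) ⟩
    π ⟨$⟩ˡ (π ⟨$⟩ʳ (ρ ⟨$⟩ˡ a))   ≡⟨ inverseˡ π ⟩
    ρ ⟨$⟩ˡ a                     ∎
    where open ≡-Reasoning

HasOrder : Group 0ℓ 0ℓ → ℕ → Set
HasOrder G m = Inverse (Group.setoid G) (setoid (Fin m))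

M : ∀ {n} → Quasigroup n → Set
M {n} f = Σ[ x ∈ Vec Σ₄ (suc n) ] head x ≡ op f (tail x)

infixr 8 _·_

_·_ : ∀ {n} {f : Quasigroup n} → Autotopy f → M f → M f
_·_ {f = f} (θ , p) (x₀ ∷ x , e) = act θ (x₀ ∷ x) ,
  trans (cong (θ zero ⟨$⟩ʳ_) (trans e (p x))) (inverseʳ (θ zero))

ActsTransitively : ∀ {n} → Quasigroup n → Set
ActsTransitively f = ∀ (u v : M f) → ∃[ θ ] proj₁ (_·_ {f = f} θ u) ≡ proj₁ v

Pair : Σ₄ → Σ₄ → Pred Σ₄ 0ℓ
Pair a b = ｛ a ｝ ∪ ｛ b ｝

Box : ∀ {n} → (Fin n → Pred Σ₄ 0ℓ) → Pred (Vec Σ₄ n) 0ℓ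
Box P x = ∀ i → lookup x i ∈ P i

Image : ∀ {n} → (Vec Σ₄ n → Σ₄) → Pred (Vec Σ₄ n) 0ℓ → Pred Σ₄ 0ℓ
Image g P y = ∃[ x ] x ∈ P × g x ≡ y

SemilinearVia : ∀ {n} → Quasigroup n → (a b : Fin (suc n) → Σ₄) → Set
SemilinearVia f a b =
  (∀ j → a j ≢ b j) ×
  Image (op f) (Box (λ i → Pair (a (suc i)) (b (suc i)))) ≐ Pair (a zero) (b zero)

Semilinear : ∀ {n} → Quasigroup n → Set
Semilinear f = ∃[ a ] ∃[ b ] SemilinearVia f a b

SemilinearIn : ∀ {n} → Quasigroup n → Fin (suc n) → Σ₄ → Σ₄ → Set
SemilinearIn f j c d = ∃[ a ] ∃[ b ] SemilinearVia f a b × a j ≡ c × b j ≡ d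

Linear : ∀ {n} → Quasigroup n → Set
Linear f = ∀ j c d → c ≢ d → SemilinearIn f j c d

Nonlinear : ∀ {n} → Quasigroup n → Set
Nonlinear f = ¬ Linear f

-- N is the maximum of |Atp(f)| over the quasigroups f satisfying P.
record IsMaxAtpOrder {n : ℕ} (P : Pred (Quasigroup n) 0ℓ) (N : ℕ) : Set where
  field
    attained : ∃[ f ] P f × HasOrder (Atp f) N
    bounded  : ∀ f → P f → ∃[ m ] HasOrder (Atp f) m × m ≤ N

{-# OPTIONS --safe #-}

-- Identify Σ with ℤ₂² (operation ⊕) and let o be the zero argument tuple.  An
-- autotopy is determined by the image of o and by its component θ₀, because θᵢ
-- can be read off θ₀ along the i-th line through o.  So the 4ⁿ points of the
-- code give |Atp f| ≤ 6 · 4ⁿ, the stabiliser of a point embedding into S₃.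
--
-- If a stabiliser contains an element of order 3, then f is affine over ℤ₂²,
-- hence linear: after normalising f along its axes, the defect f(x) ⊕ ⊕ᵢ xᵢ
-- vanishes when some xᵢ is 0 (induction on n), and a nonzero defect t would
-- spread to all points with coordinates outside {0, t}, contradicting the
-- symmetry of order 3.  So for nonlinear f stabilisers have order at most 2.
-- If one has order exactly 2, the fixed points of its transposition show that f
-- is semilinear; conversely a semilinear f always has such a transposition
-- autotopy, and a linear f has two different ones, which generate S₃.
module Submission where

open import Defs
open import Algebra.Bundles using (CommutativeRing; Group)
open import Algebra.Properties.Group using (∙-cancelˡ)
open import Data.Bool.Base using (Bool; true; false; not; _xor_; if_then_else_)
open import Data.Bool.Properties using (not-distribˡ-xor; xor-assoc; xor-comm; xor-same; xor-identityʳ; xor-∧-commutativeRing) renaming (_≟_ to _≟ᵇ_)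
open import Data.Empty using (⊥; ⊥-elim)
open import Data.Fin.Base using (Fin; zero; suc; punchOut; punchIn; _<_)
open import Data.Fin.Patterns using (0F; 1F; 2F; 3F; 4F; 5F)
open import Data.Fin.Permutation as Perm using (Permutation′; permutation; _⟨$⟩ʳ_; _⟨$⟩ˡ_; _∘ₚ_; inverseˡ; inverseʳ)
open import Data.Fin.Properties using (_≟_; _<?_; all?; any?; <-cmp; <-trans; <⇒≢; suc-injective; punchOut-injective; punchInᵢ≢i; injective⇒≤; *↔×)
open import Data.Nat.Base using (ℕ; zero; suc; _≤_; _*_; _^_; s≤s) renaming (_+_ to _ℕ+_)
import Data.Nat.Properties as ℕ
open import Data.Product.Base using (Σ-syntax; ∃-syntax; _×_; _,_; proj₁; proj₂; uncurry)
open import Data.Product.Function.NonDependent.Propositional using (_×-↔_)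
open import Data.Sum.Base using (_⊎_; inj₁; inj₂)
open import Data.Vec.Base using (Vec; []; _∷_; lookup; tabulate; replicate; uncons; foldr′; map; insertAt; removeAt; tail; _[_]≔_)
open import Data.Vec.Properties using (≡-dec; tabulate-cong; tabulate∘lookup; lookup∘tabulate; lookup-replicate; lookup-map; map-replicate; []≔-lookup; lookup∘update; lookup∘update′; map-insertAt; insertAt-removeAt)
open import Function.Base using (_∘_; case_of_)
open import Function.Bundles using (Inverse; _↔_; _⇔_; mk↔ₛ′; mk⇔; mk⤖)
open import Function.Construct.Identity using (↔-id)
open import Function.Definitions using (Injective)
open import Function.Properties.Bijection using (⤖⇒↔)
open import Function.Properties.Inverse using (↔-sym; ↔-trans)
open import Relation.Binary.Definitions using (DecidableEquality; tri<; tri≈; tri>)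
open import Relation.Binary.PropositionalEquality using (_≡_; _≢_; refl; sym; trans; cong; cong₂; subst; module ≡-Reasoning)
open import Relation.Nullary.Decidable using (Dec; yes; no; does; from-yes; map′; ¬?; _×-dec_; _⊎-dec_; _→-dec_)
open import Relation.Nullary.Negation using (¬_; contradiction)
open import Relation.Unary using (Decidable; U)

open import Algebra.Properties.CommutativeSemigroup (CommutativeRing.+-commutativeSemigroup xor-∧-commutativeRing)
  using () renaming (interchange to xor-interchange)

private
  variable
    m n : ℕ

-- Finite sets

abstract
  -- Pigeonhole: if `y` were missed, `punchOut` at `y` would compress `f` to an injection into a set
  -- with one element fewer.
  injective⇒surjective : {f : Fin n → Fin n} → Injective _≡_ _≡_ f → ∀ y → ∃[ x ] f x ≡ y
  injective⇒surjective {suc n} {f} inj y with any? (λ x → f x ≟ y)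
  ... | yes hit = hit
  ... | no miss = contradiction
    (injective⇒≤ {f = λ x → punchOut {i = y} (λ e → miss (x , sym e))} (inj ∘ punchOut-injective {i = y} _ _))
    (ℕ.<⇒≱ ℕ.≤-refl)

record Enumeration {N : ℕ} (P : Fin N → Set) : Set where
  field
    size     : ℕ
    elem     : Fin size → Fin N
    elem-inj : Injective _≡_ _≡_ elem
    sound    : ∀ j → P (elem j)
    complete : ∀ k → P k → ∃[ j ] elem j ≡ k

abstract
  enumerate : ∀ {N} {P : Fin N → Set} → Decidable P → Enumeration P
  enumerate {zero} P? = record
    { size = 0 ; elem = λ () ; elem-inj = λ { {()} } ; sound = λ () ; complete = λ () }
  enumerate {suc N} {P} P? with enumerate (P? ∘ suc) | P? zero
  ... | E | no ¬p = record
    { size = size ; elem = suc ∘ elem ; elem-inj = elem-inj ∘ suc-injective ; sound = sound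
    ; complete = λ { zero p → contradiction p ¬p
                   ; (suc k) p → let j , e = complete k p in j , cong suc e } }
    where open Enumeration E
  ... | E | yes p = record
    { size = suc size
    ; elem = λ { zero → zero ; (suc j) → suc (elem j) }
    ; elem-inj = λ { {zero} {zero} _ → refl ; {suc i} {suc j} e → cong suc (elem-inj (suc-injective e)) }
    ; sound = λ { zero → p ; (suc j) → sound j }
    ; complete = λ { zero _ → zero , refl
                   ; (suc k) p → let j , e = complete k p in suc j , cong suc e } }
    where open Enumeration E

-- Makes being an autotopy decidable, so that the autotopies among finitely many candidates can be
-- enumerated.
allVec? : ∀ {P : Vec Σ₄ n → Set} → Decidable P → Dec (∀ x → P x)
allVec? {zero}  P? = map′ (λ { p [] → p }) (λ p → p []) (P? [])
allVec? {suc n} P? = map′ (λ { p (a ∷ x) → p a x }) (λ p a x → p (a ∷ x))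
  (all? λ a → allVec? λ x → P? (a ∷ x))

Vec↔Fin : ∀ n → Vec Σ₄ n ↔ Fin (4 ^ n)
Vec↔Fin zero    = mk↔ₛ′ (λ _ → zero) (λ _ → []) (λ { zero → refl }) (λ { [] → refl })
Vec↔Fin (suc n) = ↔-trans
  (mk↔ₛ′ uncons (uncurry _∷_) (λ _ → refl) (λ { (_ ∷ _) → refl }))
  (↔-trans (↔-id Σ₄ ×-↔ Vec↔Fin n) (↔-sym *↔×))

abstract
  code↔ : ∀ k n → (Fin k × Vec Σ₄ n) ↔ Fin (k * 4 ^ n)
  code↔ k n = ↔-trans (↔-id (Fin k) ×-↔ Vec↔Fin n) (↔-sym *↔×)

↔-injective : ∀ {A B : Set} (e : A ↔ B) → Injective _≡_ _≡_ (Inverse.to e)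
↔-injective e {x} {y} eq = trans (sym (Inverse.strictlyInverseʳ e x))
  (trans (cong (Inverse.from e) eq) (Inverse.strictlyInverseʳ e y))

module _ {B : Set} (_≟ᴮ_ : DecidableEquality B) (p : Fin m → B) where

  Repeats : Fin m → Set
  Repeats i = ∃[ j ] j < i × p j ≡ p i

  repeats? : Decidable Repeats
  repeats? i = any? λ j → (j <? i) ×-dec (p j ≟ᴮ p i)

  rank : Fin m → Fin 2
  rank i = if does (repeats? i) then 1F else 0F

  rank≡1 : ∀ i → rank i ≡ 1F → Repeats i
  rank≡1 i e with repeats? i
  ... | yes r = r
  rank≡1 i () | no _

  repeats⇒rank≡1 : ∀ i → Repeats i → rank i ≡ 1F
  repeats⇒rank≡1 i r with repeats? i
  ... | yes _ = refl
  ... | no ¬r = contradiction r ¬r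

  -- With fibres of size at most two, an element is determined by its image
  -- and by whether an earlier element has the same image.
  rank-injective : (∀ {i j k} → i < j → j < k → p i ≡ p j → p j ≡ p k → ⊥) →
                   Injective _≡_ _≡_ (λ i → rank i , p i)
  rank-injective no3 {i} {j} e with <-cmp i j
  ... | tri≈ _ i≡j _ = i≡j
  ... | tri< i<j _ _ =
    let h , h<i , eq = rank≡1 i (trans (cong proj₁ e) (repeats⇒rank≡1 j (i , i<j , cong proj₂ e)))
    in ⊥-elim (no3 h<i i<j eq (cong proj₂ e))
  ... | tri> _ _ j<i =
    let h , h<j , eq = rank≡1 j (trans (sym (cong proj₁ e)) (repeats⇒rank≡1 i (j , j<i , sym (cong proj₂ e))))
    in ⊥-elim (no3 h<j j<i eq (sym (cong proj₂ e)))

-- The Klein four-group on Σ₄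

infixl 6 _⊕_

_⊕_ : Σ₄ → Σ₄ → Σ₄
0F ⊕ b  = b
1F ⊕ 0F = 1F
1F ⊕ 1F = 0F
1F ⊕ 2F = 3F
1F ⊕ 3F = 2F
2F ⊕ 0F = 2F
2F ⊕ 1F = 3F
2F ⊕ 2F = 0F
2F ⊕ 3F = 1F
3F ⊕ 0F = 3F
3F ⊕ 1F = 2F
3F ⊕ 2F = 1F
3F ⊕ 3F = 0F

abstract
  ⊕-comm : ∀ a b → a ⊕ b ≡ b ⊕ a
  ⊕-comm = from-yes (all? λ a → all? λ b → a ⊕ b ≟ b ⊕ a)

abstract
  ⊕-assoc : ∀ a b c → a ⊕ b ⊕ c ≡ a ⊕ (b ⊕ c)
  ⊕-assoc = from-yes (all? λ a → all? λ b → all? λ c → a ⊕ b ⊕ c ≟ a ⊕ (b ⊕ c))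

abstract
  ⊕-self : ∀ a → a ⊕ a ≡ 0F
  ⊕-self = from-yes (all? λ a → a ⊕ a ≟ 0F)

abstract
  ⊕-cancelʳ : ∀ a b → a ⊕ b ⊕ b ≡ a
  ⊕-cancelʳ = from-yes (all? λ a → all? λ b → a ⊕ b ⊕ b ≟ a)

⊕-injectiveˡ : ∀ c {a b} → a ⊕ c ≡ b ⊕ c → a ≡ b
⊕-injectiveˡ c {a} {b} e = trans (sym (⊕-cancelʳ a c)) (trans (cong (_⊕ c) e) (⊕-cancelʳ b c))

abstract
  ⊕≡0⇒≡ : ∀ a b → a ⊕ b ≡ 0F → a ≡ b
  ⊕≡0⇒≡ = from-yes (all? λ a → all? λ b → (a ⊕ b ≟ 0F) →-dec (a ≟ b))

shift : Σ₄ → Permutation′ 4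
shift c = permutation (_⊕ c) (_⊕ c) (λ a → ⊕-cancelʳ a c) (λ a → ⊕-cancelʳ a c)

-- 1F, 2F, 3F index the transpositions fixing that point; 4F and 5F the 3-cycles.
s₃ : Fin 6 → Σ₄ → Σ₄
s₃ k  0F = 0F
s₃ 0F a  = a
s₃ 1F 1F = 1F
s₃ 1F 2F = 3F
s₃ 1F 3F = 2F
s₃ 2F 1F = 3F
s₃ 2F 2F = 2F
s₃ 2F 3F = 1F
s₃ 3F 1F = 2F
s₃ 3F 2F = 1F
s₃ 3F 3F = 3F
s₃ 4F 1F = 2F
s₃ 4F 2F = 3F
s₃ 4F 3F = 1F
s₃ 5F 1F = 3F
s₃ 5F 2F = 1F
s₃ 5F 3F = 2F

s₃⁻¹ : Fin 6 → Fin 6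
s₃⁻¹ 4F = 5F
s₃⁻¹ 5F = 4F
s₃⁻¹ k  = k

S₃ : Fin 6 → Permutation′ 4
S₃ k = permutation (s₃ k) (s₃ (s₃⁻¹ k))
  (from-yes (all? λ k → all? λ a → s₃ k (s₃ (s₃⁻¹ k) a) ≟ a) k)
  (from-yes (all? λ k → all? λ a → s₃ (s₃⁻¹ k) (s₃ k a) ≟ a) k)

abstract
  s₃-0 : ∀ k → s₃ k 0F ≡ 0F
  s₃-0 = from-yes (all? λ k → s₃ k 0F ≟ 0F)

abstract
  -- With 0 fixed, injectivity makes the images of `1F`, `2F`, `3F` distinct and nonzero; the finite
  -- `table` then finds the matching index.
  s₃-index : {σ : Σ₄ → Σ₄} → Injective _≡_ _≡_ σ → σ 0F ≡ 0F → ∃[ k ] (∀ a → s₃ k a ≡ σ a)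
  s₃-index {σ} inj σ0 =
    let k , e₁ , e₂ , e₃ = table (σ 1F) (σ 2F) (σ 3F)
          (nonzero , nonzero , nonzero)
          ((λ e → 1≢2 (inj e)) , (λ e → 1≢3 (inj e)) , λ e → 2≢3 (inj e))
    in k , λ { 0F → trans (s₃-0 k) (sym σ0) ; 1F → e₁ ; 2F → e₂ ; 3F → e₃ }
    where
    nonzero : ∀ {a : Fin 3} → σ (suc a) ≢ 0F
    nonzero e with inj (trans e (sym σ0))
    ... | ()
    1≢2 : _≢_ {A = Σ₄} 1F 2F
    1≢2 ()
    1≢3 : _≢_ {A = Σ₄} 1F 3F
    1≢3 ()
    2≢3 : _≢_ {A = Σ₄} 2F 3F
    2≢3 ()
    table : ∀ p q r → p ≢ 0F × q ≢ 0F × r ≢ 0F → p ≢ q × p ≢ r × q ≢ r →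
            ∃[ k ] s₃ k 1F ≡ p × s₃ k 2F ≡ q × s₃ k 3F ≡ r
    table = from-yes (all? λ p → all? λ q → all? λ r →
      (¬? (p ≟ 0F) ×-dec ¬? (q ≟ 0F) ×-dec ¬? (r ≟ 0F)) →-dec
      ((¬? (p ≟ q) ×-dec ¬? (p ≟ r) ×-dec ¬? (q ≟ r)) →-dec
      any? λ k → (s₃ k 1F ≟ p) ×-dec (s₃ k 2F ≟ q) ×-dec (s₃ k 3F ≟ r)))

abstract
  s₃-injective : ∀ k l → (∀ a → s₃ k a ≡ s₃ l a) → k ≡ l
  s₃-injective = from-yes (all? λ k → all? λ l → (all? λ a → s₃ k a ≟ s₃ l a) →-dec (k ≟ l))

-- Among the `s₃ k` exactly `4F` and `5F` qualify, since all other indices fix a nonzero point.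
ThreeCycle : (Σ₄ → Σ₄) → Set
ThreeCycle σ = ∀ a → a ≢ 0F → σ a ≢ a × σ (σ a) ≢ a

threeCycle? : Decidable (ThreeCycle ∘ s₃)
threeCycle? k = all? λ a → ¬? (a ≟ 0F) →-dec (¬? (s₃ k a ≟ a) ×-dec ¬? (s₃ k (s₃ k a) ≟ a))

abstract
  -- Every permutation of the three nonzero elements of the Klein group is an automorphism, since
  -- the sum of two distinct ones is the third.
  s₃-additive : ∀ k a b → s₃ k (a ⊕ b) ≡ s₃ k a ⊕ s₃ k b
  s₃-additive = from-yes (all? λ k → all? λ a → all? λ b → s₃ k (a ⊕ b) ≟ s₃ k a ⊕ s₃ k b)

-- Autotopies

o : Vec Σ₄ n
o = replicate _ 0F

o[]≔0 : (i : Fin n) → o [ i ]≔ 0F ≡ o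
o[]≔0 i = trans (cong (o [ i ]≔_) (sym (lookup-replicate i 0F))) ([]≔-lookup o i)

act-update : (θ : Fin n → Permutation′ 4) (x : Vec Σ₄ n) (i : Fin n) (a : Σ₄) →
             act θ (x [ i ]≔ a) ≡ act θ x [ i ]≔ (θ i ⟨$⟩ʳ a)
act-update θ (_ ∷ x) zero    a = refl
act-update θ (b ∷ x) (suc i) a = cong (_ ∷_) (act-update (θ ∘ suc) x i a)

act-cong : (θ φ : Fin n → Permutation′ 4) → (∀ i → θ i Perm.≈ φ i) → ∀ x → act θ x ≡ act φ x
act-cong θ φ e x = tabulate-cong λ i → e i (lookup x i)

module _ {n} (f : Quasigroup n) where

  line : Vec Σ₄ n → Fin n → Permutation′ 4
  line v i = ⤖⇒↔ (mk⤖ (invertible f i v))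

  homotopy⇒isAutotopy : (θ : Fin (suc n) → Permutation′ 4) →
    (∀ x → op f (act (θ ∘ suc) x) ≡ θ zero ⟨$⟩ʳ op f x) → IsAutotopy f θ
  homotopy⇒isAutotopy θ h x = trans (sym (inverseˡ (θ zero))) (cong (θ zero ⟨$⟩ˡ_) (sym (h x)))

  op-act : ((θ , _) : Autotopy f) → ∀ x → op f (act (θ ∘ suc) x) ≡ θ zero ⟨$⟩ʳ op f x
  op-act (θ , p) x = trans (sym (inverseʳ (θ zero))) (cong (θ zero ⟨$⟩ʳ_) (sym (p x)))

  isAutotopy-resp-≈ : (θ φ : Fin (suc n) → Permutation′ 4) → (∀ j → θ j Perm.≈ φ j) →
    IsAutotopy f θ → IsAutotopy f φ
  isAutotopy-resp-≈ θ φ e p = homotopy⇒isAutotopy φ λ x →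
    trans (cong (op f) (sym (act-cong (θ ∘ suc) (φ ∘ suc) (e ∘ suc) x))) (trans (op-act (θ , p) x) (e zero _))

  op-act-line : (α@(θ , _) : Autotopy f) → ∀ i a →
    line (act (θ ∘ suc) o) i ⟨$⟩ʳ (θ (suc i) ⟨$⟩ʳ a) ≡ θ zero ⟨$⟩ʳ (line o i ⟨$⟩ʳ a)
  op-act-line α@(θ , _) i a =
    trans (cong (op f) (sym (act-update (θ ∘ suc) o i a))) (op-act α (o [ i ]≔ a))

  base : Autotopy f → Vec Σ₄ n
  base (θ , _) = act (θ ∘ suc) o

  -- An autotopy carries `op f o` to `op f (base α)`. Translating both values to 0 turns θ₀ into a
  -- permutation fixing 0, hence into one of the six `s₃ k`.
  normal : Autotopy f → Σ₄ → Σ₄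
  normal α@(θ , _) y = (θ zero ⟨$⟩ʳ (y ⊕ op f o)) ⊕ op f (base α)

  normal-0 : ∀ α → normal α 0F ≡ 0F
  normal-0 α = trans (cong (_⊕ op f (base α)) (sym (op-act α o))) (⊕-self (op f (base α)))

  normal-injective : ∀ α → Injective _≡_ _≡_ (normal α)
  normal-injective α@(θ , _) e =
    ⊕-injectiveˡ (op f o) (↔-injective (θ zero) (⊕-injectiveˡ (op f (base α)) e))

  index : Autotopy f → Fin 6
  index α = proj₁ (s₃-index (normal-injective α) (normal-0 α))

  s₃-index-normal : ∀ α a → s₃ (index α) a ≡ normal α a
  s₃-index-normal α = proj₂ (s₃-index (normal-injective α) (normal-0 α))

  code : Autotopy f → Fin 6 × Vec Σ₄ n
  code α = index α , base α

  -- Component 0 undoes `normal`; the others follow by matching the lines through `o` with those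
  -- through `v`. The result need not be an autotopy, and `order≤` keeps the codes for which it is.
  candidate : Fin 6 × Vec Σ₄ n → Fin (suc n) → Permutation′ 4
  candidate (k , v) zero    = shift (op f o) ∘ₚ S₃ k ∘ₚ shift (op f v)
  candidate (k , v) (suc i) = line o i ∘ₚ candidate (k , v) zero ∘ₚ Perm.flip (line v i)

  -- An autotopy is determined by the image of the point o together with θ₀,
  -- since every θᵢ can be read off θ₀ along the i-th line through o.
  candidate-code : (α@(θ , _) : Autotopy f) → ∀ j → θ j Perm.≈ candidate (code α) j
  candidate-code α@(θ , _) = both
    where
    top : θ zero Perm.≈ candidate (code α) zero
    top a = sym (trans (cong (_⊕ op f (base α)) (s₃-index-normal α (a ⊕ op f o)))
      (trans (⊕-cancelʳ _ (op f (base α))) (cong (θ zero ⟨$⟩ʳ_) (⊕-cancelʳ a (op f o)))))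
    both : ∀ j → θ j Perm.≈ candidate (code α) j
    both zero      = top
    both (suc i) a = trans (sym (inverseˡ (line (base α) i)))
      (cong (line (base α) i ⟨$⟩ˡ_) (trans (op-act-line α i a) (top _)))

  code-candidate : ∀ c (p : IsAutotopy f (candidate c)) → code (candidate c , p) ≡ c
  code-candidate c@(k , v) p = cong₂ _,_ (s₃-injective _ _ same-index) same-base
    where
    α = candidate c , p
    top-o : candidate c zero ⟨$⟩ʳ op f o ≡ op f v
    top-o = trans (cong (λ y → s₃ k y ⊕ op f v) (⊕-self (op f o))) (cong (_⊕ op f v) (s₃-0 k))
    fixed : ∀ i → candidate c (suc i) ⟨$⟩ʳ 0F ≡ lookup v i
    fixed i = trans
      (cong (λ y → line v i ⟨$⟩ˡ (candidate c zero ⟨$⟩ʳ op f y)) (o[]≔0 i))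
      (trans (cong (line v i ⟨$⟩ˡ_) (trans top-o (cong (op f) (sym ([]≔-lookup v i)))))
        (inverseˡ (line v i)))
    same-base : base α ≡ v
    same-base = trans (tabulate-cong λ i →
      trans (cong (candidate c (suc i) ⟨$⟩ʳ_) (lookup-replicate i 0F)) (fixed i)) (tabulate∘lookup v)
    same-index : ∀ a → s₃ (index α) a ≡ s₃ k a
    same-index a = trans (s₃-index-normal α a) (trans
      (cong₂ (λ y w → s₃ k y ⊕ op f v ⊕ op f w) (⊕-cancelʳ a (op f o)) same-base)
      (⊕-cancelʳ (s₃ k a) (op f v)))

  open Group (Atp f) using () renaming (_≈_ to _≋_)

  code-cong : (α β : Autotopy f) → α ≋ β → code α ≡ code β
  code-cong α β e = cong₂ _,_
    (s₃-injective _ _ λ a → trans (s₃-index-normal α a)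
      (trans (cong₂ (λ y w → y ⊕ op f w) (e zero _) same-base) (sym (s₃-index-normal β a))))
    same-base
    where
    same-base : base α ≡ base β
    same-base = act-cong (proj₁ α ∘ suc) (proj₁ β ∘ suc) (e ∘ suc) o

  code-injective : (α β : Autotopy f) → code α ≡ code β → α ≋ β
  code-injective α β e j a = trans (candidate-code α j a)
    (trans (cong (λ c → candidate c j ⟨$⟩ʳ a) e) (sym (candidate-code β j a)))

  -- Codes classify autotopies, so the order is the number of codes, among 6 · 4ⁿ, whose candidate
  -- passes the decidable test of being an autotopy.
  order≤ : ∃[ m ] HasOrder (Atp f) m × m ≤ 6 * 4 ^ n
  order≤ = size , record
    { to        = λ α → proj₁ (find α)
    ; from      = generator
    ; to-cong   = λ {α} {β} e → elem-inj (trans (proj₂ (find α))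
        (trans (cong C.to (code-cong α β e)) (sym (proj₂ (find β)))))
    ; from-cong = λ { refl _ _ → refl }
    ; inverse   = (λ {j} {α} e → elem-inj (trans (proj₂ (find α))
                      (trans (cong C.to (trans (code-cong α (generator j) e) (code-candidate _ (sound j))))
                        (C.strictlyInverseˡ (elem j)))))
                , (λ {α} {j} e → code-injective (generator j) α
                      (trans (code-candidate _ (sound j))
                        (trans (cong C.from (trans (cong elem e) (proj₂ (find α))))
                          (C.strictlyInverseʳ (code α)))))
    } , injective⇒≤ elem-inj
    where
    module C = Inverse (code↔ 6 n)
    open Enumeration (enumerate (λ c → allVec? λ x →
      op f x ≟ candidate (C.from c) zero ⟨$⟩ˡ op f (act (candidate (C.from c) ∘ suc) x)))
    generator : Fin size → Autotopy f
    generator j = candidate (C.from (elem j)) , sound j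
    find : ∀ α → ∃[ j ] elem j ≡ C.to (code α)
    find α@(θ , p) = complete _ (isAutotopy-resp-≈ θ (candidate (C.from (C.to (code α))))
      (λ j a → trans (candidate-code α j a)
        (cong (λ c → candidate c j ⟨$⟩ʳ a) (sym (C.strictlyInverseʳ (code α))))) p)

  code-surjective⇒order : (∀ c → ∃[ α ] code α ≡ c) → HasOrder (Atp f) (6 * 4 ^ n)
  code-surjective⇒order surj = record
    { to        = C.to ∘ code
    ; from      = choice
    ; to-cong   = λ {α} {β} e → cong C.to (code-cong α β e)
    ; from-cong = λ { refl _ _ → refl }
    ; inverse   = (λ {j} {α} e → trans
                      (cong C.to (trans (code-cong α (choice j) e) (proj₂ (surj (C.from j)))))
                      (C.strictlyInverseˡ j))
                , (λ { {α} refl → code-injective (choice (C.to (code α))) α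
                      (trans (proj₂ (surj _)) (C.strictlyInverseʳ (code α))) })
    }
    where
    module C = Inverse (code↔ 6 n)
    choice : Fin (6 * 4 ^ n) → Autotopy f
    choice j = proj₁ (surj (C.from j))

  from-injective : ∀ {m} (H : HasOrder (Atp f) m) → ∀ i j → Inverse.from H i ≋ Inverse.from H j → i ≡ j
  from-injective H i j e = trans (sym (H.strictlyInverseˡ i))
    (trans (H.to-cong {H.from i} {H.from j} e) (H.strictlyInverseˡ j))
    where module H = Inverse H

  -- Listing the group by codes is an injection between sets of equal size.
  order⇒code-surjective : HasOrder (Atp f) (6 * 4 ^ n) → ∀ c → ∃[ α ] code α ≡ c
  order⇒code-surjective H c =
    let j , e = injective⇒surjective {f = C.to ∘ code ∘ H.from} inj (C.to c)
    in H.from j , ↔-injective (code↔ 6 n) e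
    where
    module C = Inverse (code↔ 6 n)
    module H = Inverse H
    inj : Injective _≡_ _≡_ (C.to ∘ code ∘ H.from)
    inj {i} {j} e = from-injective H i j
      (code-injective (H.from i) (H.from j) (↔-injective (code↔ 6 n) e))

-- Affine quasigroups

⨁ : Vec Σ₄ n → Σ₄
⨁ = foldr′ _⊕_ 0F

⨁-update : (x : Vec Σ₄ n) (i : Fin n) (a : Σ₄) → ⨁ (x [ i ]≔ a) ≡ ⨁ (x [ i ]≔ 0F) ⊕ a
⨁-update (_ ∷ x) zero    a = ⊕-comm a (⨁ x)
⨁-update (b ∷ x) (suc i) a = trans (cong (b ⊕_) (⨁-update x i a)) (sym (⊕-assoc b _ a))

⨁-insertAt : (x : Vec Σ₄ n) (i : Fin (suc n)) → ⨁ (insertAt x i 0F) ≡ ⨁ x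
⨁-insertAt x       zero    = refl
⨁-insertAt (a ∷ x) (suc i) = cong (a ⊕_) (⨁-insertAt x i)

⨁-map : ∀ k (x : Vec Σ₄ n) → ⨁ (map (s₃ k) x) ≡ s₃ k (⨁ x)
⨁-map k []      = sym (s₃-0 k)
⨁-map k (a ∷ x) = trans (cong (s₃ k a ⊕_) (⨁-map k x)) (sym (s₃-additive k a (⨁ x)))

insertAt-update : (x : Vec Σ₄ n) (i : Fin (suc n)) (b : Σ₄) (j : Fin n) (a : Σ₄) →
                  insertAt x i b [ punchIn i j ]≔ a ≡ insertAt (x [ j ]≔ a) i b
insertAt-update x       zero    b j       a = refl
insertAt-update (c ∷ x) (suc i) b zero    a = refl
insertAt-update (c ∷ x) (suc i) b (suc j) a = cong (c ∷_) (insertAt-update x i b j a)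

insertAt-o : ∀ {n} (i : Fin (suc n)) → insertAt o i 0F ≡ o
insertAt-o         zero    = refl
insertAt-o {suc n} (suc i) = cong (0F ∷_) (insertAt-o i)

-- The defect of a Latin function from the sum

Latin : (Vec Σ₄ n → Σ₄) → Set
Latin g = ∀ i x → Injective _≡_ _≡_ (λ a → g (x [ i ]≔ a))

abstract
  -- A 3-cycle σ is impossible: it is additive without nonzero fixed points, so σ z ⊕ z runs through
  -- all of `Σ₄` and takes the value `c`. The identity and the transpositions are involutions.
  avoids-translation⇒involutive : {ℓ : Σ₄ → Σ₄} {c : Σ₄} → Injective _≡_ _≡_ ℓ → ℓ 0F ≡ 0F →
    c ≢ 0F → (∀ z → ℓ z ≢ c ⊕ z) → ∀ z → ℓ (ℓ z) ≡ z
  avoids-translation⇒involutive {ℓ} {c} inj ℓ0 c≢0 avoid z =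
    let k , e = s₃-index inj ℓ0 in
    trans (sym (trans (e _) (cong ℓ (e z))))
      (table k c c≢0 (λ y q → avoid y (trans (sym (e y)) q)) z)
    where
    table : ∀ k c → c ≢ 0F → (∀ z → s₃ k z ≢ c ⊕ z) → ∀ z → s₃ k (s₃ k z) ≡ z
    table = from-yes (all? λ k → all? λ c → ¬? (c ≟ 0F) →-dec
      ((all? λ z → ¬? (s₃ k z ≟ c ⊕ z)) →-dec (all? λ z → s₃ k (s₃ k z) ≟ z)))

  only-two-left : ∀ t a r → t ≢ 0F → a ≢ 0F → a ≢ t → r ≢ 0F → r ≢ t → a ≡ r ⊎ t ⊕ a ≡ r
  only-two-left = from-yes (all? λ t → all? λ a → all? λ r →
    ¬? (t ≟ 0F) →-dec (¬? (a ≟ 0F) →-dec (¬? (a ≟ t) →-dec (¬? (r ≟ 0F) →-dec (¬? (r ≟ t) →-dec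
    ((a ≟ r) ⊎-dec (t ⊕ a ≟ r)))))))

  s₃-nonzero : ∀ k a → a ≢ 0F → s₃ k a ≢ 0F
  s₃-nonzero = from-yes (all? λ k → all? λ a → ¬? (a ≟ 0F) →-dec ¬? (s₃ k a ≟ 0F))

-- The coordinates are corrected one at a time, the last one first; each already is `r` or becomes
-- `r` after a single translation by `t`.
walk : (D : Vec Σ₄ n → Set) (t r : Σ₄) → (∀ i x → D x → D (x [ i ]≔ (t ⊕ lookup x i))) →
       ∀ x → (∀ i → lookup x i ≡ r ⊎ t ⊕ lookup x i ≡ r) → D x → D (replicate n r)
walk D t r step []      near d = d
walk {suc n} D t r step (a ∷ x) near d
  with walk (D ∘ (a ∷_)) t r (λ i y → step (suc i) (a ∷ y)) x (near ∘ suc) | near zero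
... | rest | inj₁ refl = rest d
... | rest | inj₂ e    = subst (λ b → D (b ∷ replicate n r)) e (step zero (a ∷ replicate n r) (rest d))

module Defect {n} (g : Vec Σ₄ (2 ℕ+ n) → Σ₄) (latin : Latin g)
              (sum-at-zero : ∀ x i → lookup x i ≡ 0F → g x ≡ ⨁ x) where

  defect : Vec Σ₄ (2 ℕ+ n) → Σ₄
  defect x = g x ⊕ ⨁ x

  defect-at-zero : ∀ x i → lookup x i ≡ 0F → defect x ≡ 0F
  defect-at-zero x i e = trans (cong (_⊕ ⨁ x) (sum-at-zero x i e)) (⊕-self (⨁ x))

  defect-nonzero⇒lookup : ∀ x i → defect x ≢ 0F → lookup x i ≢ 0F
  defect-nonzero⇒lookup x i d≢0 e = d≢0 (defect-at-zero x i e)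

  -- If the defect equalled the nonzero xᵢ, then `g x` would be the sum without xᵢ, which is the
  -- value of `g` after setting that coordinate to 0, against the Latin property.
  defect≢lookup : ∀ x i → lookup x i ≢ 0F → defect x ≢ lookup x i
  defect≢lookup x i x≢0 e = x≢0 (latin i x (begin
    g (x [ i ]≔ lookup x i)                           ≡⟨ cong g ([]≔-lookup x i) ⟩
    g x                                               ≡⟨ sym (⊕-cancelʳ (g x) (⨁ x)) ⟩
    defect x ⊕ ⨁ x                                    ≡⟨ cong₂ _⊕_ e (cong ⨁ (sym ([]≔-lookup x i))) ⟩
    lookup x i ⊕ ⨁ (x [ i ]≔ lookup x i)              ≡⟨ cong (lookup x i ⊕_) (⨁-update x i (lookup x i)) ⟩
    lookup x i ⊕ (⨁ (x [ i ]≔ 0F) ⊕ lookup x i)       ≡⟨ ⊕-comm (lookup x i) _ ⟩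
    ⨁ (x [ i ]≔ 0F) ⊕ lookup x i ⊕ lookup x i         ≡⟨ ⊕-cancelʳ _ (lookup x i) ⟩
    ⨁ (x [ i ]≔ 0F)                                   ≡⟨ sym (sum-at-zero _ i (lookup∘update i x 0F)) ⟩
    g (x [ i ]≔ 0F)                                   ∎))
    where open ≡-Reasoning

  -- Along a line, z ↦ defect ⊕ z fixes 0, and avoids every nonzero coordinate
  -- off the line as a translation; such a permutation is an involution.
  defect-step : ∀ t → t ≢ 0F → ∀ i x → defect x ≡ t → defect (x [ i ]≔ (t ⊕ lookup x i)) ≡ t
  defect-step t t≢0 i x d = begin
    defect (x [ i ]≔ (t ⊕ lookup x i))                   ≡⟨ sym (⊕-cancelʳ _ (t ⊕ lookup x i)) ⟩
    ℓ (t ⊕ lookup x i) ⊕ (t ⊕ lookup x i)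
      ≡⟨ cong (λ y → ℓ (y ⊕ lookup x i) ⊕ (t ⊕ lookup x i)) (sym d′) ⟩
    ℓ (ℓ (lookup x i)) ⊕ (t ⊕ lookup x i)                ≡⟨ cong (_⊕ (t ⊕ lookup x i)) involutive ⟩
    lookup x i ⊕ (t ⊕ lookup x i)                        ≡⟨ ⊕-comm (lookup x i) _ ⟩
    t ⊕ lookup x i ⊕ lookup x i                          ≡⟨ ⊕-cancelʳ t (lookup x i) ⟩
    t                                                    ∎
    where
    open ≡-Reasoning
    ℓ : Σ₄ → Σ₄
    ℓ z = defect (x [ i ]≔ z) ⊕ z
    d′ : defect (x [ i ]≔ lookup x i) ≡ t
    d′ = trans (cong defect ([]≔-lookup x i)) d
    -- Arity at least two provides a coordinate off the line; it is nonzero, as a zero coordinate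
    -- would make the defect vanish.
    j = punchIn i zero
    c≢0 : lookup x j ≢ 0F
    c≢0 = defect-nonzero⇒lookup x j (λ e → t≢0 (trans (sym d) e))
    ℓ-eq : ∀ z → ℓ z ≡ g (x [ i ]≔ z) ⊕ ⨁ (x [ i ]≔ 0F)
    ℓ-eq z = trans (cong (λ s → g (x [ i ]≔ z) ⊕ s ⊕ z) (⨁-update x i z))
      (trans (cong (_⊕ z) (sym (⊕-assoc (g (x [ i ]≔ z)) _ z))) (⊕-cancelʳ _ z))
    ℓ-injective : Injective _≡_ _≡_ ℓ
    ℓ-injective {y} {z} e = latin i x (⊕-injectiveˡ _ (trans (sym (ℓ-eq y)) (trans e (ℓ-eq z))))
    ℓ-0 : ℓ 0F ≡ 0F
    ℓ-0 = cong (_⊕ 0F) (defect-at-zero _ i (lookup∘update i x 0F))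
    same : ∀ z → lookup (x [ i ]≔ z) j ≡ lookup x j
    same z = lookup∘update′ (punchInᵢ≢i i zero) x z
    avoid : ∀ z → ℓ z ≢ lookup x j ⊕ z
    avoid z e = defect≢lookup (x [ i ]≔ z) j (λ q → c≢0 (trans (sym (same z)) q))
      (trans (⊕-injectiveˡ z e) (sym (same z)))
    involutive : ℓ (ℓ (lookup x i)) ≡ lookup x i
    involutive = avoids-translation⇒involutive ℓ-injective ℓ-0 c≢0 avoid (lookup x i)

  -- With t the defect of `x`, every coordinate lies outside {0, t} and so is `r` or `t ⊕ r`;
  -- `defect-step` passes between these two without changing the defect.
  defect-constant : ∀ x r → defect x ≢ 0F → r ≢ 0F → r ≢ defect x → defect (replicate _ r) ≡ defect x
  defect-constant x r d≢0 r≢0 r≢d = walk (λ y → defect y ≡ defect x) (defect x) r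
    (defect-step (defect x) d≢0) x
    (λ i → only-two-left (defect x) (lookup x i) r d≢0
      (nonzero i) (λ e → defect≢lookup x i (nonzero i) (sym e)) r≢0 r≢d)
    refl
    where
    nonzero : ∀ i → lookup x i ≢ 0F
    nonzero i = defect-nonzero⇒lookup x i d≢0

  defect-map : ∀ k → (∀ x → g (map (s₃ k) x) ≡ s₃ k (g x)) → ∀ x → defect (map (s₃ k) x) ≡ s₃ k (defect x)
  defect-map k equi x = trans (cong₂ _⊕_ (equi x) (⨁-map k x)) (sym (s₃-additive k (g x) (⨁ x)))

  -- A nonzero defect t propagates to all constant vectors r ∉ {0, t}, which the
  -- symmetry of order 3 contradicts.
  equivariant⇒no-defect : ∀ k → ThreeCycle (s₃ k) → (∀ x → g (map (s₃ k) x) ≡ s₃ k (g x)) →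
    ∀ x → g x ≡ ⨁ x
  equivariant⇒no-defect k cyc equi x with defect x ≟ 0F
  ... | yes d≡0 = ⊕≡0⇒≡ _ _ d≡0
  ... | no t≢0 = contradiction (begin
    s₃ k t
      ≡⟨ cong (s₃ k) (sym (defect-constant x (s₃ k t) t≢0 st≢0 (proj₁ (cyc t t≢0)))) ⟩
    s₃ k (defect (replicate _ (s₃ k t)))         ≡⟨ sym (defect-map k equi (replicate _ (s₃ k t))) ⟩
    defect (map (s₃ k) (replicate _ (s₃ k t)))   ≡⟨ cong defect (map-replicate (s₃ k) (s₃ k t) _) ⟩
    defect (replicate _ (s₃ k (s₃ k t)))         ≡⟨ defect-constant x _ t≢0 (s₃-nonzero k _ st≢0) (proj₂ (cyc t t≢0)) ⟩
    t                                            ∎) (proj₁ (cyc t t≢0))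
    where
    open ≡-Reasoning
    t = defect x
    st≢0 : s₃ k t ≢ 0F
    st≢0 = s₃-nonzero k t t≢0

-- Normalised functions, by induction on the arity

module _ (k : Fin 6) where

  -- The shape of a quasigroup in coordinates that make each axis through `o` the identity; a
  -- stabiliser of `o` then acts in all coordinates by the same `s₃ k`.
  record Normalised (g : Vec Σ₄ n → Σ₄) : Set where
    field
      latin       : Latin g
      at-o        : g o ≡ 0F
      on-axis     : ∀ i a → g (o [ i ]≔ a) ≡ a
      equivariant : ∀ x → g (map (s₃ k) x) ≡ s₃ k (g x)

  open Normalised

  normalised-insertAt : {g : Vec Σ₄ (suc n) → Σ₄} → Normalised g →
    ∀ i → Normalised (λ y → g (insertAt y i 0F))
  normalised-insertAt {g = g} N i = record
    { latin       = λ j y {a} {b} q → latin N (punchIn i j) (insertAt y i 0F)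
        (trans (cong g (insertAt-update y i 0F j a))
          (trans q (cong g (sym (insertAt-update y i 0F j b)))))
    ; at-o        = trans (cong g (insertAt-o i)) (at-o N)
    ; on-axis     = λ j a → trans
        (cong g (trans (sym (insertAt-update o i 0F j a)) (cong (_[ punchIn i j ]≔ a) (insertAt-o i))))
        (on-axis N (punchIn i j) a)
    ; equivariant = λ y → trans
        (cong g (trans (cong (insertAt (map (s₃ k) y) i) (sym (s₃-0 k))) (sym (map-insertAt (s₃ k) 0F y i))))
        (equivariant N (insertAt y i 0F))
    }

  sum-at-zero : (∀ {g : Vec Σ₄ n → Σ₄} → Normalised g → ∀ x → g x ≡ ⨁ x) →
    ∀ {g : Vec Σ₄ (suc n) → Σ₄} → Normalised g → ∀ x i → lookup x i ≡ 0F → g x ≡ ⨁ x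
  sum-at-zero rec {g} N x i e = begin
    g x                                     ≡⟨ cong g (sym refill) ⟩
    g (insertAt (removeAt x i) i 0F)        ≡⟨ rec (normalised-insertAt N i) (removeAt x i) ⟩
    ⨁ (removeAt x i)                        ≡⟨ sym (⨁-insertAt (removeAt x i) i) ⟩
    ⨁ (insertAt (removeAt x i) i 0F)        ≡⟨ cong ⨁ refill ⟩
    ⨁ x                                     ∎
    where
    open ≡-Reasoning
    refill : insertAt (removeAt x i) i 0F ≡ x
    refill = trans (cong (insertAt (removeAt x i) i) (sym e)) (insertAt-removeAt x i)

  -- Arities 0 and 1 are read off the normalisation; from 2 on, the induction hypothesis on the
  -- coordinate hyperplanes feeds the defect argument.
  normalised⇒sum : ThreeCycle (s₃ k) → ∀ n {g : Vec Σ₄ n → Σ₄} → Normalised g → ∀ x → g x ≡ ⨁ x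
  normalised⇒sum cyc zero          N []       = at-o N
  normalised⇒sum cyc (suc zero)    N (a ∷ []) = trans (on-axis N zero a) (⊕-comm 0F a)
  normalised⇒sum cyc (suc (suc n)) N          =
    Defect.equivariant⇒no-defect _ (latin N)
      (sum-at-zero (normalised⇒sum cyc (suc n)) N) k cyc (equivariant N)

-- Affinity from a 3-cycle in the stabiliser of `o`

Affine : Quasigroup n → Set
Affine {n} f = Σ[ w ∈ Σ₄ ] Σ[ α ∈ (Fin n → Permutation′ 4) ] (∀ x → op f x ≡ ⨁ (act α x) ⊕ w)

module _ {n} (f : Quasigroup n) where

  op-latin : Latin (op f)
  op-latin i x = proj₁ (invertible f i x)

  axis : Fin n → Permutation′ 4
  axis i = line f o i ∘ₚ shift (op f o)

  axis-0 : ∀ i → axis i ⟨$⟩ʳ 0F ≡ 0F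
  axis-0 i = trans (cong (λ y → op f y ⊕ op f o) (o[]≔0 i)) (⊕-self (op f o))

  axis⁻¹-0 : ∀ i → axis i ⟨$⟩ˡ 0F ≡ 0F
  axis⁻¹-0 i = trans (cong (axis i ⟨$⟩ˡ_) (sym (axis-0 i))) (inverseˡ (axis i))

  -- A stabiliser of `o` maps each axis to itself, and θ₀ acts on the values along every axis; so in
  -- axis coordinates all θᵢ are the same permutation.
  axis-conjugates : (α@(θ , _) : Autotopy f) → base f α ≡ o →
    ∀ i a → axis i ⟨$⟩ʳ (θ (suc i) ⟨$⟩ʳ a) ≡ s₃ (index f α) (axis i ⟨$⟩ʳ a)
  axis-conjugates α@(θ , _) fix i a = begin
    op f (o [ i ]≔ (θ (suc i) ⟨$⟩ʳ a)) ⊕ op f o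
      ≡⟨ cong (λ v → op f (v [ i ]≔ (θ (suc i) ⟨$⟩ʳ a)) ⊕ op f o) (sym fix) ⟩
    op f (base f α [ i ]≔ (θ (suc i) ⟨$⟩ʳ a)) ⊕ op f o
      ≡⟨ cong₂ _⊕_ (op-act-line f α i a) (cong (op f) (sym fix)) ⟩
    (θ zero ⟨$⟩ʳ op f (o [ i ]≔ a)) ⊕ op f (base f α)
      ≡⟨ cong (λ y → (θ zero ⟨$⟩ʳ y) ⊕ op f (base f α)) (sym (⊕-cancelʳ _ (op f o))) ⟩
    normal f α (axis i ⟨$⟩ʳ a)
      ≡⟨ sym (s₃-index-normal f α _) ⟩
    s₃ (index f α) (axis i ⟨$⟩ʳ a) ∎
    where open ≡-Reasoning

  normal-fixed : (α@(θ , _) : Autotopy f) → base f α ≡ o →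
    ∀ y → (θ zero ⟨$⟩ʳ y) ⊕ op f o ≡ s₃ (index f α) (y ⊕ op f o)
  normal-fixed α@(θ , _) fix y = sym (trans (s₃-index-normal f α (y ⊕ op f o))
    (cong₂ (λ z v → (θ zero ⟨$⟩ʳ z) ⊕ op f v) (⊕-cancelʳ y (op f o)) fix))

  -- Relabelling every argument by `axis` and translating the value by `op f o` turns `f` into a
  -- normalised `g`, to which `normalised⇒sum` applies.
  threeCycle⇒affine : (α : Autotopy f) → base f α ≡ o → ThreeCycle (s₃ (index f α)) → Affine f
  threeCycle⇒affine α@(θ , _) fix cyc = op f o , axis , λ x → begin
    op f x                                                   ≡⟨ cong (op f) (sym (act-inverse (Perm.flip ∘ axis) x)) ⟩
    op f (act (Perm.flip ∘ axis) (act axis x))               ≡⟨ sym (⊕-cancelʳ _ (op f o)) ⟩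
    g (act axis x) ⊕ op f o                                  ≡⟨ cong (_⊕ op f o) (g-sum (act axis x)) ⟩
    ⨁ (act axis x) ⊕ op f o                                  ∎
    where
    open ≡-Reasoning
    k = index f α
    g : Vec Σ₄ n → Σ₄
    g y = op f (act (Perm.flip ∘ axis) y) ⊕ op f o
    act-o : act (Perm.flip ∘ axis) o ≡ o
    act-o = trans (tabulate-cong λ i → trans (cong (axis i ⟨$⟩ˡ_) (lookup-replicate i 0F))
      (trans (axis⁻¹-0 i) (sym (lookup-replicate i 0F)))) (tabulate∘lookup o)
    equi : ∀ y → g (map (s₃ k) y) ≡ s₃ k (g y)
    equi y = trans (cong (λ z → op f z ⊕ op f o)
        (trans (tabulate-cong pointwise) (act-∘ (θ ∘ suc) (Perm.flip ∘ axis) y)))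
      (trans (cong (_⊕ op f o) (op-act f α _)) (normal-fixed α fix _))
      where
      pointwise : ∀ i → axis i ⟨$⟩ˡ lookup (map (s₃ k) y) i ≡ θ (suc i) ⟨$⟩ʳ (axis i ⟨$⟩ˡ lookup y i)
      pointwise i = trans (cong (axis i ⟨$⟩ˡ_) (trans (lookup-map i (s₃ k) y)
          (trans (cong (s₃ k) (sym (inverseʳ (axis i)))) (sym (axis-conjugates α fix i _)))))
        (inverseˡ (axis i))
    g-sum : ∀ y → g y ≡ ⨁ y
    g-sum = normalised⇒sum k cyc n record
      { latin       = λ i y {a} {b} e → ↔-injective (Perm.flip (axis i)) (op-latin i (act (Perm.flip ∘ axis) y)
          (trans (cong (op f) (sym (act-update (Perm.flip ∘ axis) y i a)))
            (trans (⊕-injectiveˡ (op f o) e) (cong (op f) (act-update (Perm.flip ∘ axis) y i b)))))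
      ; at-o        = trans (cong (λ z → op f z ⊕ op f o) act-o) (⊕-self (op f o))
      ; on-axis     = λ i a → trans (cong (λ z → op f z ⊕ op f o)
            (trans (act-update (Perm.flip ∘ axis) o i a) (cong (_[ i ]≔ (axis i ⟨$⟩ˡ a)) act-o)))
          (inverseʳ (axis i))
      ; equivariant = equi
      }

-- Linearity and autotopies of affine quasigroups

abstract
  ⊕-interchange : ∀ a b c d → a ⊕ b ⊕ (c ⊕ d) ≡ a ⊕ c ⊕ (b ⊕ d)
  ⊕-interchange = from-yes (all? λ a → all? λ b → all? λ c → all? λ d → a ⊕ b ⊕ (c ⊕ d) ≟ a ⊕ c ⊕ (b ⊕ d))

  ⊕-cancelˡ : ∀ a b → a ⊕ (a ⊕ b) ≡ b
  ⊕-cancelˡ = from-yes (all? λ a → all? λ b → a ⊕ (a ⊕ b) ≟ b)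

  ⊕-nonzero : ∀ a b → a ≢ b → a ⊕ b ≢ 0F
  ⊕-nonzero = from-yes (all? λ a → all? λ b → ¬? (a ≟ b) →-dec ¬? (a ⊕ b ≟ 0F))

  ≢⊕ : ∀ a e → e ≢ 0F → a ≢ a ⊕ e
  ≢⊕ = from-yes (all? λ a → all? λ e → ¬? (e ≟ 0F) →-dec ¬? (a ≟ a ⊕ e))

-- Only the parity of the number of deviating coordinates matters, as `e ⊕ e` is 0.
⨁-pair : ∀ e (y b : Vec Σ₄ n) → (∀ i → lookup y i ≡ lookup b i ⊎ lookup y i ≡ lookup b i ⊕ e) →
         ⨁ y ≡ ⨁ b ⊎ ⨁ y ≡ ⨁ b ⊕ e
⨁-pair e []      []      near = inj₁ refl
⨁-pair e (p ∷ y) (q ∷ b) near with near zero | ⨁-pair e y b (near ∘ suc)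
... | inj₁ h | inj₁ t = inj₁ (cong₂ _⊕_ h t)
... | inj₁ h | inj₂ t = inj₂ (trans (cong₂ _⊕_ h t) (sym (⊕-assoc q (⨁ b) e)))
... | inj₂ h | inj₁ t = inj₂ (trans (cong₂ _⊕_ h t) (trans (⊕-assoc q e (⨁ b))
  (trans (cong (q ⊕_) (⊕-comm e (⨁ b))) (sym (⊕-assoc q (⨁ b) e)))))
... | inj₂ h | inj₂ t = inj₁ (trans (cong₂ _⊕_ h t)
  (trans (⊕-interchange q e (⨁ b) e) (trans (cong (q ⊕ ⨁ b ⊕_) (⊕-self e)) (⊕-comm _ 0F))))

⨁-affine : ∀ k (z x y v : Vec Σ₄ n) →
  (∀ i → lookup z i ≡ s₃ k (lookup x i ⊕ lookup y i) ⊕ lookup v i) →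
  ⨁ z ≡ s₃ k (⨁ x ⊕ ⨁ y) ⊕ ⨁ v
⨁-affine k []      []      []      []      e = sym (cong (_⊕ 0F) (s₃-0 k))
⨁-affine k (c ∷ z) (a ∷ x) (b ∷ y) (d ∷ v) e = begin
  c ⊕ ⨁ z                                              ≡⟨ cong₂ _⊕_ (e zero) (⨁-affine k z x y v (e ∘ suc)) ⟩
  s₃ k (a ⊕ b) ⊕ d ⊕ (s₃ k (⨁ x ⊕ ⨁ y) ⊕ ⨁ v)          ≡⟨ ⊕-interchange (s₃ k (a ⊕ b)) d _ (⨁ v) ⟩
  s₃ k (a ⊕ b) ⊕ s₃ k (⨁ x ⊕ ⨁ y) ⊕ (d ⊕ ⨁ v)          ≡⟨ cong (_⊕ (d ⊕ ⨁ v)) (sym (s₃-additive k (a ⊕ b) _)) ⟩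
  s₃ k (a ⊕ b ⊕ (⨁ x ⊕ ⨁ y)) ⊕ (d ⊕ ⨁ v)
    ≡⟨ cong (λ t → s₃ k t ⊕ (d ⊕ ⨁ v)) (⊕-interchange a b (⨁ x) (⨁ y)) ⟩
  s₃ k (a ⊕ ⨁ x ⊕ (b ⊕ ⨁ y)) ⊕ (d ⊕ ⨁ v)               ∎
  where open ≡-Reasoning

-- In the coordinates αᵢ, the cosets of {0, e} through a point `a` add up to a single coset of {0,
-- e}. Every pair in every argument is such a coset, with `e` the difference of its two elements.
affine⇒linear : (f : Quasigroup (suc n)) → Affine f → Linear f
affine⇒linear {n} f (w , α , f-eq) = linear
  where
  module _ (a : Vec Σ₄ (suc n)) (e : Σ₄) (e≢0 : e ≢ 0F) where
    A B : Fin (suc (suc n)) → Σ₄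
    A zero    = op f a
    A (suc i) = lookup a i
    B zero    = op f a ⊕ e
    B (suc i) = α i ⟨$⟩ˡ ((α i ⟨$⟩ʳ lookup a i) ⊕ e)

    α-B : ∀ i → α i ⟨$⟩ʳ B (suc i) ≡ (α i ⟨$⟩ʳ lookup a i) ⊕ e
    α-B i = inverseʳ (α i)

    distinct : ∀ j → A j ≢ B j
    distinct zero    = ≢⊕ (op f a) e e≢0
    distinct (suc i) q = ≢⊕ _ e e≢0 (trans (cong (α i ⟨$⟩ʳ_) q) (α-B i))

    shifted : ∀ x → ⨁ (act α x) ≡ ⨁ (act α a) ⊕ e → op f x ≡ op f a ⊕ e
    shifted x q = trans (f-eq x) (trans (cong (_⊕ w) q) (trans (⊕-assoc _ e w)
      (trans (cong (⨁ (act α a) ⊕_) (⊕-comm e w))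
        (trans (sym (⊕-assoc _ w e)) (cong (_⊕ e) (sym (f-eq a)))))))

    into : ∀ x → Box (λ i → Pair (A (suc i)) (B (suc i))) x → Pair (A zero) (B zero) (op f x)
    into x box with ⨁-pair e (act α x) (act α a) near
      where
      near : ∀ i → lookup (act α x) i ≡ lookup (act α a) i ⊎ lookup (act α x) i ≡ lookup (act α a) i ⊕ e
      near i rewrite lookup∘tabulate (λ i → α i ⟨$⟩ʳ lookup x i) i
                   | lookup∘tabulate (λ i → α i ⟨$⟩ʳ lookup a i) i with box i
      ... | inj₁ q = inj₁ (cong (α i ⟨$⟩ʳ_) (sym q))
      ... | inj₂ q = inj₂ (trans (cong (α i ⟨$⟩ʳ_) (sym q)) (α-B i))
    ... | inj₁ q = inj₁ (trans (f-eq a) (trans (cong (_⊕ w) (sym q)) (sym (f-eq x))))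
    ... | inj₂ q = inj₂ (sym (shifted x q))

    onto : ∀ y → Pair (A zero) (B zero) y → Image (op f) (Box (λ i → Pair (A (suc i)) (B (suc i)))) y
    onto y (inj₁ q) = a , (λ i → inj₁ refl) , q
    -- Moving only the first argument to its partner shifts the value by `e`; positive arity
    -- supplies that argument.
    onto y (inj₂ q) = a [ zero ]≔ B (suc zero) , box , trans (shifted _ sum) q
      where
      box : Box (λ i → Pair (A (suc i)) (B (suc i))) (a [ zero ]≔ B (suc zero))
      box zero    = inj₂ (sym (lookup∘update zero a _))
      box (suc i) = inj₁ (sym (lookup∘update′ {i = suc i} {zero} (λ ()) a _))
      sum : ⨁ (act α (a [ zero ]≔ B (suc zero))) ≡ ⨁ (act α a) ⊕ e
      sum = begin
        ⨁ (act α (a [ zero ]≔ B (suc zero)))                             ≡⟨ cong ⨁ (act-update α a zero _) ⟩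
        ⨁ (act α a [ zero ]≔ (α zero ⟨$⟩ʳ B (suc zero)))
          ≡⟨ cong (λ t → ⨁ (act α a [ zero ]≔ t)) (α-B zero) ⟩
        ⨁ (act α a [ zero ]≔ ((α zero ⟨$⟩ʳ lookup a zero) ⊕ e))          ≡⟨ ⨁-update (act α a) zero _ ⟩
        S ⊕ ((α zero ⟨$⟩ʳ lookup a zero) ⊕ e)                            ≡⟨ sym (⊕-assoc S _ e) ⟩
        S ⊕ (α zero ⟨$⟩ʳ lookup a zero) ⊕ e
          ≡⟨ cong (_⊕ e) (sym (⨁-update (act α a) zero _)) ⟩
        ⨁ (act α a [ zero ]≔ (α zero ⟨$⟩ʳ lookup a zero)) ⊕ e
          ≡⟨ cong (λ t → ⨁ t ⊕ e) (sym (act-update α a zero _)) ⟩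
        ⨁ (act α (a [ zero ]≔ lookup a zero)) ⊕ e
          ≡⟨ cong (λ t → ⨁ (act α t) ⊕ e) ([]≔-lookup a zero) ⟩
        ⨁ (act α a) ⊕ e                                                  ∎
        where
        open ≡-Reasoning
        S = ⨁ (act α a [ zero ]≔ 0F)

    via : SemilinearVia f A B
    via = distinct , (λ { (x , box , refl) → into x box }) , λ {y} → onto y

  linear : Linear f
  linear zero c d c≢d = A a e e≢0 , B a e e≢0 , via a e e≢0 , f-a , trans (cong (_⊕ e) f-a) (⊕-cancelˡ c d)
    where
    e   = c ⊕ d
    e≢0 = ⊕-nonzero c d c≢d
    a   = o [ zero ]≔ (line f o zero ⟨$⟩ˡ c)
    f-a : op f a ≡ c
    f-a = inverseʳ (line f o zero)
  linear (suc i) c d c≢d = A a e e≢0 , B a e e≢0 , via a e e≢0 , at-i ,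
    trans (cong (λ t → α i ⟨$⟩ˡ ((α i ⟨$⟩ʳ t) ⊕ e)) at-i)
      (trans (cong (α i ⟨$⟩ˡ_) (⊕-cancelˡ (α i ⟨$⟩ʳ c) (α i ⟨$⟩ʳ d))) (inverseˡ (α i)))
    where
    e   = (α i ⟨$⟩ʳ c) ⊕ (α i ⟨$⟩ʳ d)
    e≢0 = ⊕-nonzero _ _ (λ q → c≢d (↔-injective (α i) q))
    a   = o [ i ]≔ c
    at-i : lookup a i ≡ c
    at-i = lookup∘update i o c

-- In the coordinates αᵢ every component of the candidate is an affine map with linear part `s₃ k`,
-- and such maps pass through the sum by `⨁-affine`.
affine⇒code-surjective : (f : Quasigroup n) → Affine f → ∀ c → ∃[ α ] code f α ≡ c
affine⇒code-surjective {n} f (w , α , f-eq) c@(k , v) = (candidate f c , autotopy) , code-candidate f c autotopy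
  where
  open ≡-Reasoning
  θ = candidate f c

  op-update : ∀ u i a → op f (u [ i ]≔ a) ≡ (α i ⟨$⟩ʳ a) ⊕ (α i ⟨$⟩ʳ lookup u i) ⊕ op f u
  op-update u i a = begin
    op f (u [ i ]≔ a)                                 ≡⟨ split a ⟩
    S ⊕ (α i ⟨$⟩ʳ a) ⊕ w                              ≡⟨ rearrange S (α i ⟨$⟩ʳ a) (α i ⟨$⟩ʳ lookup u i) w ⟩
    (α i ⟨$⟩ʳ a) ⊕ (α i ⟨$⟩ʳ lookup u i) ⊕ (S ⊕ (α i ⟨$⟩ʳ lookup u i) ⊕ w)
      ≡⟨ cong ((α i ⟨$⟩ʳ a) ⊕ (α i ⟨$⟩ʳ lookup u i) ⊕_)
           (trans (sym (split (lookup u i))) (cong (op f) ([]≔-lookup u i))) ⟩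
    (α i ⟨$⟩ʳ a) ⊕ (α i ⟨$⟩ʳ lookup u i) ⊕ op f u     ∎
    where
    S = ⨁ (act α u [ i ]≔ 0F)
    split : ∀ a → op f (u [ i ]≔ a) ≡ S ⊕ (α i ⟨$⟩ʳ a) ⊕ w
    split a = trans (f-eq _) (cong (_⊕ w) (trans (cong ⨁ (act-update α u i a)) (⨁-update (act α u) i _)))
    rearrange : ∀ s a b w → s ⊕ a ⊕ w ≡ a ⊕ b ⊕ (s ⊕ b ⊕ w)
    rearrange s a b w = trans (cong (_⊕ w) (trans (⊕-comm s a)
        (trans (cong (a ⊕_) (sym (⊕-cancelˡ b s))) (trans (sym (⊕-assoc a b (b ⊕ s))) (cong (a ⊕ b ⊕_) (⊕-comm b s))))))
      (⊕-assoc (a ⊕ b) (s ⊕ b) w)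

  α-θ : ∀ i a → α i ⟨$⟩ʳ (θ (suc i) ⟨$⟩ʳ a) ≡
                s₃ k ((α i ⟨$⟩ʳ a) ⊕ (α i ⟨$⟩ʳ lookup o i)) ⊕ (α i ⟨$⟩ʳ lookup v i)
  α-θ i a = begin
    α i ⟨$⟩ʳ b                                                    ≡⟨ sym (⊕-cancelʳ _ (α i ⟨$⟩ʳ lookup v i)) ⟩
    (α i ⟨$⟩ʳ b) ⊕ (α i ⟨$⟩ʳ lookup v i) ⊕ (α i ⟨$⟩ʳ lookup v i)
      ≡⟨ cong (_⊕ (α i ⟨$⟩ʳ lookup v i)) (⊕-injectiveˡ (op f v) on-line) ⟩
    s₃ k ((α i ⟨$⟩ʳ a) ⊕ (α i ⟨$⟩ʳ lookup o i)) ⊕ (α i ⟨$⟩ʳ lookup v i) ∎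
    where
    b = θ (suc i) ⟨$⟩ʳ a
    on-line : (α i ⟨$⟩ʳ b) ⊕ (α i ⟨$⟩ʳ lookup v i) ⊕ op f v ≡ s₃ k ((α i ⟨$⟩ʳ a) ⊕ (α i ⟨$⟩ʳ lookup o i)) ⊕ op f v
    on-line = trans (sym (op-update v i b)) (trans (inverseʳ (line f v i))
      (cong (λ t → s₃ k t ⊕ op f v) (trans (cong (_⊕ op f o) (op-update o i a)) (⊕-cancelʳ _ (op f o)))))

  autotopy : IsAutotopy f θ
  autotopy = homotopy⇒isAutotopy f θ λ x → begin
    op f (act (θ ∘ suc) x)                                            ≡⟨ f-eq _ ⟩
    ⨁ (act α (act (θ ∘ suc) x)) ⊕ w
      ≡⟨ cong (_⊕ w) (⨁-affine k (act α (act (θ ∘ suc) x)) (act α x) (act α o) (act α v) (pointwise x)) ⟩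
    s₃ k (⨁ (act α x) ⊕ ⨁ (act α o)) ⊕ ⨁ (act α v) ⊕ w                ≡⟨ ⊕-assoc _ (⨁ (act α v)) w ⟩
    s₃ k (⨁ (act α x) ⊕ ⨁ (act α o)) ⊕ (⨁ (act α v) ⊕ w)
      ≡⟨ cong₂ (λ s t → s₃ k s ⊕ t) (differ x) (sym (f-eq v)) ⟩
    s₃ k (op f x ⊕ op f o) ⊕ op f v                                   ∎
    where
    differ : ∀ x → ⨁ (act α x) ⊕ ⨁ (act α o) ≡ op f x ⊕ op f o
    differ x = sym (trans (cong₂ _⊕_ (f-eq x) (f-eq o)) (trans (⊕-interchange (⨁ (act α x)) w (⨁ (act α o)) w)
      (trans (cong (⨁ (act α x) ⊕ ⨁ (act α o) ⊕_) (⊕-self w)) (⊕-comm _ 0F))))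
    pointwise : ∀ x i → lookup (act α (act (θ ∘ suc) x)) i ≡
                s₃ k (lookup (act α x) i ⊕ lookup (act α o) i) ⊕ lookup (act α v) i
    pointwise x i rewrite lookup∘tabulate (λ i → α i ⟨$⟩ʳ lookup (act (θ ∘ suc) x) i) i
                        | lookup∘tabulate (λ i → θ (suc i) ⟨$⟩ʳ lookup x i) i
                        | lookup∘tabulate (λ i → α i ⟨$⟩ʳ lookup x i) i
                        | lookup∘tabulate (λ i → α i ⟨$⟩ʳ lookup o i) i
                        | lookup∘tabulate (λ i → α i ⟨$⟩ʳ lookup v i) i = α-θ i (lookup x i)

-- Stabilisers of a point of the code

abstract
  -- In S₃ the product of two distinct transpositions is a 3-cycle.
  two-generate-threeCycle : ∀ k l → k ≢ 0F → l ≢ 0F → k ≢ l →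
    ThreeCycle (s₃ k) ⊎ ThreeCycle (s₃ l) ⊎ (∀ h → (∀ a → s₃ h a ≡ s₃ k (s₃ l a)) → ThreeCycle (s₃ h))
  two-generate-threeCycle = from-yes (all? λ k → all? λ l →
    ¬? (k ≟ 0F) →-dec (¬? (l ≟ 0F) →-dec (¬? (k ≟ l) →-dec
    (threeCycle? k ⊎-dec threeCycle? l ⊎-dec
      (all? λ h → (all? λ a → s₃ h a ≟ s₃ k (s₃ l a)) →-dec threeCycle? h)))))

  transposition-fixes : ∀ k → k ≢ 0F → ¬ ThreeCycle (s₃ k) →
    ∃[ t ] t ≢ 0F × s₃ k t ≡ t × (∀ y → s₃ k y ≡ y → y ≡ 0F ⊎ y ≡ t)
  transposition-fixes = from-yes (all? λ k → ¬? (k ≟ 0F) →-dec (¬? (threeCycle? k) →-dec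
    (any? λ t → ¬? (t ≟ 0F) ×-dec (s₃ k t ≟ t) ×-dec
      (all? λ y → (s₃ k y ≟ y) →-dec ((y ≟ 0F) ⊎-dec (y ≟ t))))))

module _ {n} (f : Quasigroup n) where

  open Group (Atp f) using (_∙_)

  base-∙ : ∀ α β → base f β ≡ o → base f (α ∙ β) ≡ base f α
  base-∙ α@(θ , _) β@(φ , _) fix = trans (act-∘ (θ ∘ suc) (φ ∘ suc) o) (cong (act (θ ∘ suc)) fix)

  -- For a stabiliser of `o`, θ₀ fixes `op f o`, so the recentring in `normal` is the same for all
  -- of them and the index behaves as a homomorphism into S₃.
  index-∙ : ∀ α β → base f α ≡ o → base f β ≡ o →
            ∀ a → s₃ (index f (α ∙ β)) a ≡ s₃ (index f α) (s₃ (index f β) a)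
  index-∙ α@(θ , _) β@(φ , _) fixα fixβ a = begin
    s₃ (index f (α ∙ β)) a                     ≡⟨ cong (s₃ (index f (α ∙ β))) (sym a-eq) ⟩
    s₃ (index f (α ∙ β)) (y ⊕ op f o)          ≡⟨ sym (normal-fixed f (α ∙ β) (trans (base-∙ α β fixβ) fixα) y) ⟩
    (θ zero ⟨$⟩ʳ (φ zero ⟨$⟩ʳ y)) ⊕ op f o     ≡⟨ normal-fixed f α fixα (φ zero ⟨$⟩ʳ y) ⟩
    s₃ (index f α) ((φ zero ⟨$⟩ʳ y) ⊕ op f o)  ≡⟨ cong (s₃ (index f α)) (normal-fixed f β fixβ y) ⟩
    s₃ (index f α) (s₃ (index f β) (y ⊕ op f o)) ≡⟨ cong (s₃ (index f α) ∘ s₃ (index f β)) a-eq ⟩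
    s₃ (index f α) (s₃ (index f β) a)          ∎
    where
    open ≡-Reasoning
    y = a ⊕ op f o
    a-eq : y ⊕ op f o ≡ a
    a-eq = ⊕-cancelʳ a (op f o)

  two-stabilisers⇒affine : ∀ α β → base f α ≡ o → base f β ≡ o →
    index f α ≢ 0F → index f β ≢ 0F → index f α ≢ index f β → Affine f
  two-stabilisers⇒affine α β fixα fixβ α≢ β≢ α≢β with two-generate-threeCycle (index f α) (index f β) α≢ β≢ α≢β
  ... | inj₁ cyc        = threeCycle⇒affine f α fixα cyc
  ... | inj₂ (inj₁ cyc) = threeCycle⇒affine f β fixβ cyc
  ... | inj₂ (inj₂ cyc) = threeCycle⇒affine f (α ∙ β) (trans (base-∙ α β fixβ) fixα)
                            (cyc _ (index-∙ α β fixα fixβ))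

-- The fixed points of a transposition in the stabiliser form the box of a semilinear structure.
stabiliser⇒semilinear : (f : Quasigroup (suc n)) → Nonlinear f → ∀ α → base f α ≡ o →
  index f α ≢ 0F → Semilinear f
stabiliser⇒semilinear {n} f nonlinear α@(θ , _) fix k≢0 =
  A , B , distinct , (λ { (x , box , refl) → into x box }) , λ {y} → onto y
  where
  k = index f α
  transposition = transposition-fixes k k≢0 λ cyc →
    nonlinear (affine⇒linear f (threeCycle⇒affine f α fix cyc))
  t       = proj₁ transposition
  t≢0     = proj₁ (proj₂ transposition)
  t-fixed = proj₁ (proj₂ (proj₂ transposition))
  t-only  = proj₂ (proj₂ (proj₂ transposition))

  A B : Fin (suc (suc n)) → Σ₄
  A zero    = op f o
  A (suc i) = 0F
  B zero    = t ⊕ op f o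
  B (suc i) = axis f i ⟨$⟩ˡ t

  axis-B : ∀ i → axis f i ⟨$⟩ʳ B (suc i) ≡ t
  axis-B i = inverseʳ (axis f i)

  distinct : ∀ j → A j ≢ B j
  distinct zero    q = t≢0 (⊕-injectiveˡ (op f o) (sym q))
  distinct (suc i) q = t≢0 (trans (sym (axis-B i)) (trans (cong (axis f i ⟨$⟩ʳ_) (sym q)) (axis-0 f i)))

  fixed-by : ∀ i a → s₃ k (axis f i ⟨$⟩ʳ a) ≡ axis f i ⟨$⟩ʳ a → θ (suc i) ⟨$⟩ʳ a ≡ a
  fixed-by i a q = ↔-injective (axis f i) (trans (axis-conjugates f α fix i a) q)

  fixed : ∀ i a → Pair (A (suc i)) (B (suc i)) a → θ (suc i) ⟨$⟩ʳ a ≡ a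
  fixed i a (inj₁ refl) = fixed-by i a (trans (cong (s₃ k) (axis-0 f i)) (trans (s₃-0 k) (sym (axis-0 f i))))
  fixed i a (inj₂ refl) = fixed-by i a (trans (cong (s₃ k) (axis-B i)) (trans t-fixed (sym (axis-B i))))

  into : ∀ x → Box (λ i → Pair (A (suc i)) (B (suc i))) x → Pair (A zero) (B zero) (op f x)
  -- The autotopy fixes every point of the box, so θ₀ fixes its value; recentred at `op f o`, this
  -- value is a fixed point of `s₃ k`, hence 0 or `t`.
  into x box with t-only (op f x ⊕ op f o) (trans (sym (normal-fixed f α fix (op f x)))
    (cong (_⊕ op f o) (trans (sym (op-act f α x))
      (cong (op f) (trans (tabulate-cong (λ i → fixed i (lookup x i) (box i))) (tabulate∘lookup x))))))
  ... | inj₁ q = inj₁ (sym (⊕≡0⇒≡ _ _ q))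
  ... | inj₂ q = inj₂ (trans (cong (_⊕ op f o) (sym q)) (⊕-cancelʳ (op f x) (op f o)))

  onto : ∀ y → Pair (A zero) (B zero) y → Image (op f) (Box (λ i → Pair (A (suc i)) (B (suc i)))) y
  onto y (inj₁ q) = o , (λ i → inj₁ (sym (lookup-replicate i 0F))) , q
  onto y (inj₂ q) = o [ zero ]≔ B (suc zero) , box ,
    trans (trans (sym (⊕-cancelʳ _ (op f o))) (cong (_⊕ op f o) (axis-B zero))) q
    where
    box : Box (λ i → Pair (A (suc i)) (B (suc i))) (o [ zero ]≔ B (suc zero))
    box zero    = inj₂ refl
    box (suc i) = inj₁ (sym (lookup-replicate i 0F))

-- Parity characters and the transposition of a semilinear structure

-- For e ≢ 0, χ e is the character of the Klein group with kernel {0, e}.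
χ : Σ₄ → Σ₄ → Bool
χ e a = not (does ((a ≟ 0F) ⊎-dec (a ≟ e)))

infixr 7 _⊗_

_⊗_ : Bool → Σ₄ → Σ₄
false ⊗ e = 0F
true  ⊗ e = e

transp : Σ₄ → Fin 6
transp 0F = 0F
transp 1F = 1F
transp 2F = 2F
transp 3F = 3F

abstract
  -- For nonzero `e` this is a transvection: adding `e` exactly outside {0, e} swaps the other two
  -- elements.
  transp-⊕ : ∀ e a → s₃ (transp e) a ≡ a ⊕ χ e a ⊗ e
  transp-⊕ = from-yes (all? λ e → all? λ a → s₃ (transp e) a ≟ a ⊕ χ e a ⊗ e)

  transp-injective : ∀ d e → transp d ≡ transp e → d ≡ e
  transp-injective = from-yes (all? λ d → all? λ e → (transp d ≟ transp e) →-dec (d ≟ e))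

  χ-⊕ : ∀ e a b → e ≢ 0F → χ e (a ⊕ b) ≡ χ e a xor χ e b
  χ-⊕ = from-yes (all? λ e → all? λ a → all? λ b → ¬? (e ≟ 0F) →-dec (χ e (a ⊕ b) ≟ᵇ χ e a xor χ e b))

  χ-self : ∀ e → χ e e ≡ false
  χ-self = from-yes (all? λ e → χ e e ≟ᵇ false)

  χ≡⇒⊕ : ∀ e p q → e ≢ 0F → p ≢ q → χ e p ≡ χ e q → p ≡ q ⊕ e
  χ≡⇒⊕ = from-yes (all? λ e → all? λ p → all? λ q →
    ¬? (e ≟ 0F) →-dec (¬? (p ≟ q) →-dec ((χ e p ≟ᵇ χ e q) →-dec (p ≟ q ⊕ e))))

  χ-third : ∀ e p q r → e ≢ 0F → p ≢ q → r ≢ p → r ≢ q → χ e p ≡ χ e q → χ e r ≡ not (χ e p)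
  χ-third = from-yes (all? λ e → all? λ p → all? λ q → all? λ r →
    ¬? (e ≟ 0F) →-dec (¬? (p ≟ q) →-dec (¬? (r ≟ p) →-dec (¬? (r ≟ q) →-dec
    ((χ e p ≟ᵇ χ e q) →-dec (χ e r ≟ᵇ not (χ e p)))))))

  χ-inside : ∀ a b → χ (a ⊕ b) (a ⊕ a) ≡ false × χ (a ⊕ b) (b ⊕ a) ≡ false
  χ-inside = from-yes (all? λ a → all? λ b → (χ (a ⊕ b) (a ⊕ a) ≟ᵇ false) ×-dec (χ (a ⊕ b) (b ⊕ a) ≟ᵇ false))

  χ-outside : ∀ a b p → p ≢ a → p ≢ b → χ (a ⊕ b) (p ⊕ a) ≡ true
  χ-outside = from-yes (all? λ a → all? λ b → all? λ p →
    ¬? (p ≟ a) →-dec (¬? (p ≟ b) →-dec (χ (a ⊕ b) (p ⊕ a) ≟ᵇ true)))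

⊗-xor : ∀ s t e → s ⊗ e ⊕ t ⊗ e ≡ (s xor t) ⊗ e
⊗-xor false t     e = refl
⊗-xor true  false e = ⊕-comm e 0F
⊗-xor true  true  e = ⊕-self e

-- When `e i` is `a i ⊕ b i` with `a i ≢ b i`, this is the parity of the number of coordinates
-- outside their pair {a i, b i}.
χs : (a e : Fin n → Σ₄) → Vec Σ₄ n → Bool
χs a e []      = false
χs a e (p ∷ x) = χ (e zero) (p ⊕ a zero) xor χs (a ∘ suc) (e ∘ suc) x

-- Both points of the pair {a, b} on a line give values in one χ-class, hence
-- exhaust it, so the remaining two points give values in the other class.
parity : ∀ {n} (g : Vec Σ₄ n → Σ₄) → Latin g → ∀ ε → ε ≢ 0F → (a b : Fin n → Σ₄) → (∀ i → a i ≢ b i) → ∀ c →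
  (∀ x → Box (λ i → Pair (a i) (b i)) x → χ ε (g x) ≡ c) →
  ∀ x → χ ε (g x) ≡ χs a (λ i → a i ⊕ b i) x xor c
parity {zero}  g latin ε ε≢0 a b a≢b c box []      = box [] λ ()
parity {suc n} g latin ε ε≢0 a b a≢b c box (p ∷ x) = cases (p ≟ a zero) (p ≟ b zero)
  where
  s = χs (a ∘ suc) (λ i → a (suc i) ⊕ b (suc i)) x
  inside : ∀ q → Pair (a zero) (b zero) q → χ ε (g (q ∷ x)) ≡ s xor c
  inside q q∈ = parity (g ∘ (q ∷_)) (λ i y → latin (suc i) (q ∷ y)) ε ε≢0 (a ∘ suc) (b ∘ suc) (a≢b ∘ suc) c
    (λ y y∈ → box (q ∷ y) λ { zero → q∈ ; (suc i) → y∈ i }) x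
  differ : ∀ {q r} → q ≢ r → g (q ∷ x) ≢ g (r ∷ x)
  differ q≢r e = q≢r (latin zero (p ∷ x) e)
  cases : Dec (p ≡ a zero) → Dec (p ≡ b zero) → χ ε (g (p ∷ x)) ≡ (χ (a zero ⊕ b zero) (p ⊕ a zero) xor s) xor c
  cases (yes refl) _ = trans (inside p (inj₁ refl))
    (cong (λ h → (h xor s) xor c) (sym (proj₁ (χ-inside (a zero) (b zero)))))
  cases (no _) (yes refl) = trans (inside p (inj₂ refl))
    (cong (λ h → (h xor s) xor c) (sym (proj₂ (χ-inside (a zero) (b zero)))))
  cases (no p≢a) (no p≢b) = trans
    (χ-third ε (g (a zero ∷ x)) (g (b zero ∷ x)) (g (p ∷ x)) ε≢0 (differ (a≢b zero)) (differ p≢a) (differ p≢b)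
      (trans (inside _ (inj₁ refl)) (sym (inside _ (inj₂ refl)))))
    (trans (cong not (inside _ (inj₁ refl)))
      (trans (not-distribˡ-xor s c) (cong (λ h → (h xor s) xor c) (sym (χ-outside (a zero) (b zero) p p≢a p≢b)))))

abstract
  χ-invariant : ∀ e p a → e ≢ 0F → χ e (p ⊕ e ⊕ a) ≡ χ e (p ⊕ a)
  χ-invariant = from-yes (all? λ e → all? λ p → all? λ a → ¬? (e ≟ 0F) →-dec (χ e (p ⊕ e ⊕ a) ≟ᵇ χ e (p ⊕ a)))

-- Additivity of the characters cancels the reference points `a`.
χs-difference : (a e : Fin n → Σ₄) → (∀ i → e i ≢ 0F) → ∀ x →
  χs a e x xor χs a e o ≡ χs (λ _ → 0F) e x
χs-difference a e e≢0 []      = refl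
χs-difference a e e≢0 (p ∷ x) = trans
  (xor-interchange (χ (e zero) (p ⊕ a zero)) (χs (a ∘ suc) (e ∘ suc) x) (χ (e zero) (a zero)) _)
  (cong₂ _xor_
    (trans (sym (χ-⊕ (e zero) (p ⊕ a zero) (a zero) (e≢0 zero)))
      (cong (χ (e zero)) (trans (⊕-cancelʳ p (a zero)) (⊕-comm 0F p))))
    (χs-difference (a ∘ suc) (e ∘ suc) (e≢0 ∘ suc) x))

-- A coordinate either stays put or moves by its `e i`. Such a move keeps the parity, hence the
-- class of the value modulo {0, ε}; the Latin property forbids an equal value, so the value moves
-- by exactly ε.
act-transp : ∀ {n} (g : Vec Σ₄ n → Σ₄) → Latin g → ∀ ε → ε ≢ 0F → (a e : Fin n → Σ₄) → (∀ i → e i ≢ 0F) → ∀ c →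
  (∀ x → χ ε (g x) ≡ χs a e x xor c) →
  ∀ x → g (act (S₃ ∘ transp ∘ e) x) ≡ g x ⊕ χs (λ _ → 0F) e x ⊗ ε
act-transp {zero}  g latin ε ε≢0 a e e≢0 c par []      = ⊕-comm 0F (g [])
act-transp {suc n} g latin ε ε≢0 a e e≢0 c par (p ∷ x) = begin
  g (p′ ∷ act (S₃ ∘ transp ∘ e ∘ suc) x)
    ≡⟨ act-transp (g ∘ (p′ ∷_)) (λ i y → latin (suc i) (p′ ∷ y)) ε ε≢0 (a ∘ suc) (e ∘ suc) (e≢0 ∘ suc)
         (χ (e zero) (p′ ⊕ a zero) xor c)
         (λ y → trans (par (p′ ∷ y)) (trans (cong (_xor c) (xor-comm (χ (e zero) (p′ ⊕ a zero)) _))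
           (xor-assoc (χs (a ∘ suc) (e ∘ suc) y) _ c))) x ⟩
  g (p′ ∷ x) ⊕ t ⊗ ε                          ≡⟨ cong (_⊕ t ⊗ ε) (head-step (χ (e zero) p) refl) ⟩
  g (p ∷ x) ⊕ χ (e zero) p ⊗ ε ⊕ t ⊗ ε        ≡⟨ ⊕-assoc (g (p ∷ x)) _ _ ⟩
  g (p ∷ x) ⊕ (χ (e zero) p ⊗ ε ⊕ t ⊗ ε)      ≡⟨ cong (g (p ∷ x) ⊕_) (⊗-xor (χ (e zero) p) t ε) ⟩
  g (p ∷ x) ⊕ (χ (e zero) p xor t) ⊗ ε
    ≡⟨ cong (λ q → g (p ∷ x) ⊕ (χ (e zero) q xor t) ⊗ ε) (⊕-comm 0F p) ⟩
  g (p ∷ x) ⊕ (χ (e zero) (p ⊕ 0F) xor t) ⊗ ε ∎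
  where
  open ≡-Reasoning
  p′ = s₃ (transp (e zero)) p
  t  = χs (λ _ → 0F) (e ∘ suc) x
  head-step : ∀ h → χ (e zero) p ≡ h → g (p′ ∷ x) ≡ g (p ∷ x) ⊕ h ⊗ ε
  head-step false eq = trans
    (cong (λ q → g (q ∷ x)) (trans (transp-⊕ (e zero) p) (trans (cong (λ h → p ⊕ h ⊗ e zero) eq) (⊕-comm p 0F))))
    (⊕-comm 0F _)
  head-step true eq = χ≡⇒⊕ ε _ _ ε≢0
    (λ q → ≢⊕ p (e zero) (e≢0 zero) (trans (sym (latin zero (p ∷ x) q)) p′-eq))
    (trans (par (p′ ∷ x)) (trans (cong (λ h → (h xor χs (a ∘ suc) (e ∘ suc) x) xor c)
        (trans (cong (λ q → χ (e zero) (q ⊕ a zero)) p′-eq) (χ-invariant (e zero) p (a zero) (e≢0 zero))))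
      (sym (par (p ∷ x)))))
    where
    p′-eq : p′ ≡ p ⊕ e zero
    p′-eq = trans (transp-⊕ (e zero) p) (cong (λ h → p ⊕ h ⊗ e zero) eq)

-- In each argument take the transposition fixing the difference of its pair. The value is shifted
-- by ε exactly when its class differs from that of `op f o`, so θ₀ is a transvection as well,
-- recentred at `op f o`.
semilinear⇒stabiliser : (f : Quasigroup n) (a b : Fin (suc n) → Σ₄) → SemilinearVia f a b →
  ∃[ α ] base f α ≡ o × index f α ≡ transp (a zero ⊕ b zero)
semilinear⇒stabiliser {n} f a b (a≢b , image , _) = α , fix , s₃-injective _ _ same-index
  where
  open ≡-Reasoning
  e : Fin (suc n) → Σ₄
  e j = a j ⊕ b j
  e≢0 : ∀ j → e j ≢ 0F
  e≢0 j = ⊕-nonzero (a j) (b j) (a≢b j)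
  ε = e zero
  θ : Fin (suc n) → Permutation′ 4
  θ zero    = shift (op f o) ∘ₚ S₃ (transp ε) ∘ₚ shift (op f o)
  θ (suc i) = S₃ (transp (e (suc i)))
  in-class : ∀ y → Pair (a zero) (b zero) y → χ ε y ≡ χ ε (a zero)
  in-class y (inj₁ refl) = refl
  in-class y (inj₂ refl) = trans (cong (χ ε) (sym (⊕-cancelˡ (a zero) y)))
    (trans (cong (χ ε) (sym (⊕-comm ε (a zero))))
      (trans (χ-⊕ ε ε (a zero) (e≢0 zero)) (cong (_xor χ ε (a zero)) (χ-self ε))))
  par : ∀ x → χ ε (op f x) ≡ χs (a ∘ suc) (e ∘ suc) x xor χ ε (a zero)
  par = parity (op f) (op-latin f) ε (e≢0 zero) (a ∘ suc) (b ∘ suc) (a≢b ∘ suc) (χ ε (a zero))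
    (λ x x∈ → in-class _ (image (x , x∈ , refl)))
  total : ∀ x → χs (λ _ → 0F) (e ∘ suc) x ≡ χ ε (op f x ⊕ op f o)
  total x = sym (begin
    χ ε (op f x ⊕ op f o)                             ≡⟨ χ-⊕ ε (op f x) (op f o) (e≢0 zero) ⟩
    χ ε (op f x) xor χ ε (op f o)                     ≡⟨ cong₂ _xor_ (par x) (par o) ⟩
    (sx xor c) xor (so xor c)                         ≡⟨ xor-interchange sx c so c ⟩
    (sx xor so) xor (c xor c)                         ≡⟨ cong ((sx xor so) xor_) (xor-same c) ⟩
    (sx xor so) xor false                             ≡⟨ xor-identityʳ (sx xor so) ⟩
    sx xor so                                         ≡⟨ χs-difference (a ∘ suc) (e ∘ suc) (e≢0 ∘ suc) x ⟩
    χs (λ _ → 0F) (e ∘ suc) x                         ∎)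
    where
    c  = χ ε (a zero)
    sx = χs (a ∘ suc) (e ∘ suc) x
    so = χs (a ∘ suc) (e ∘ suc) o
  autotopy : IsAutotopy f θ
  autotopy = homotopy⇒isAutotopy f θ λ x → begin
    op f (act (θ ∘ suc) x)
      ≡⟨ act-transp (op f) (op-latin f) ε (e≢0 zero) (a ∘ suc) (e ∘ suc) (e≢0 ∘ suc) (χ ε (a zero)) par x ⟩
    op f x ⊕ χs (λ _ → 0F) (e ∘ suc) x ⊗ ε
      ≡⟨ cong₂ (λ y s → y ⊕ s ⊗ ε) (sym (⊕-cancelʳ (op f x) (op f o))) (total x) ⟩
    op f x ⊕ op f o ⊕ op f o ⊕ χ ε (op f x ⊕ op f o) ⊗ ε
      ≡⟨ trans (⊕-assoc (op f x ⊕ op f o) (op f o) _) (trans (cong (op f x ⊕ op f o ⊕_) (⊕-comm (op f o) _))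
           (sym (⊕-assoc (op f x ⊕ op f o) _ (op f o)))) ⟩
    op f x ⊕ op f o ⊕ χ ε (op f x ⊕ op f o) ⊗ ε ⊕ op f o
      ≡⟨ cong (_⊕ op f o) (sym (transp-⊕ ε (op f x ⊕ op f o))) ⟩
    s₃ (transp ε) (op f x ⊕ op f o) ⊕ op f o ∎
  α : Autotopy f
  α = θ , autotopy
  fix : base f α ≡ o
  fix = trans (tabulate-cong λ i → trans (cong (s₃ (transp (e (suc i)))) (lookup-replicate i 0F))
    (trans (s₃-0 (transp (e (suc i)))) (sym (lookup-replicate i 0F)))) (tabulate∘lookup o)
  same-index : ∀ y → s₃ (index f α) y ≡ s₃ (transp ε) y
  same-index y = trans (s₃-index-normal f α y) (trans
    (cong₂ (λ z v → s₃ (transp ε) z ⊕ op f o ⊕ op f v) (⊕-cancelʳ y (op f o)) fix)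
    (⊕-cancelʳ _ (op f o)))

-- The value pairs {0, 1} and {0, 2} give two stabilisers of `o` with the distinct transpositions
-- `1F` and `2F` as indices.
linear⇒affine : (f : Quasigroup n) → Linear f → Affine f
linear⇒affine f linear =
  let a₁ , b₁ , via₁ , a₁≡ , b₁≡ = linear zero 0F 1F (λ ())
      a₂ , b₂ , via₂ , a₂≡ , b₂≡ = linear zero 0F 2F (λ ())
      α , fixα , iα = semilinear⇒stabiliser f a₁ b₁ via₁
      β , fixβ , iβ = semilinear⇒stabiliser f a₂ b₂ via₂
      iα′ = trans iα (cong transp (cong₂ _⊕_ a₁≡ b₁≡))
      iβ′ = trans iβ (cong transp (cong₂ _⊕_ a₂≡ b₂≡))
  in two-stabilisers⇒affine f α β fixα fixβ
       (λ q → case trans (sym iα′) q of λ ())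
       (λ q → case trans (sym iβ′) q of λ ())
       (λ q → case trans (sym iα′) (trans q iβ′) of λ ())

-- Counting autotopies by the image of `o`

module _ {n} (f : Quasigroup n) where

  open Group (Atp f) using (_∙_; ε; _⁻¹) renaming (_≈_ to _≋_; trans to ≋-trans; sym to ≋-sym)

  code-ε : code f ε ≡ (0F , o)
  code-ε = cong₂ _,_ (s₃-injective (index f ε) 0F λ a → trans (s₃-index-normal f ε a)
      (trans (cong (λ v → a ⊕ op f o ⊕ op f v) (act-id o)) (trans (⊕-cancelʳ a (op f o)) (s₃-id a))))
    (act-id o)
    where
    s₃-id : ∀ a → a ≡ s₃ 0F a
    s₃-id = from-yes (all? λ a → a ≟ s₃ 0F a)

  stabiliser-trivial : ∀ α → base f α ≡ o → index f α ≡ 0F → α ≋ ε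
  stabiliser-trivial α fix i≡0 = code-injective f α ε (trans (cong₂ _,_ i≡0 fix) (sym code-ε))

  ⁻¹∙-fixes : ∀ α β → base f α ≡ base f β → base f (α ⁻¹ ∙ β) ≡ o
  ⁻¹∙-fixes α@(θ , _) β@(φ , _) e = trans (act-∘ (Perm.flip ∘ θ ∘ suc) (φ ∘ suc) o)
    (trans (cong (act (Perm.flip ∘ θ ∘ suc)) (sym e)) (act-inverse (Perm.flip ∘ θ ∘ suc) o))

  ⁻¹∙-trivial : ∀ α β → base f α ≡ base f β → index f (α ⁻¹ ∙ β) ≡ 0F → α ≋ β
  ⁻¹∙-trivial α β e i≡0 = ≋-sym {β} {α} (∙-cancelˡ (Atp f) (α ⁻¹) β α
    (≋-trans {α ⁻¹ ∙ β} {ε} {α ⁻¹ ∙ α} (stabiliser-trivial (α ⁻¹ ∙ β) (⁻¹∙-fixes α β e) i≡0)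
      (λ j a → sym (inverseˡ (proj₁ α j)))))

  -- Three autotopies sending o to the same point would give two distinct
  -- nontrivial stabilisers, hence one of order 3.
  same-base⇒affine : ∀ α β γ → base f α ≡ base f β → base f β ≡ base f γ →
    ¬ α ≋ β → ¬ β ≋ γ → ¬ α ≋ γ → Affine f
  same-base⇒affine α β γ eαβ eβγ α≉β β≉γ α≉γ =
    two-stabilisers⇒affine f (α ⁻¹ ∙ β) (α ⁻¹ ∙ γ) fixβ fixγ
      (α≉β ∘ ⁻¹∙-trivial α β eαβ) (α≉γ ∘ ⁻¹∙-trivial α γ eαγ)
      (λ i≡ → β≉γ (∙-cancelˡ (Atp f) (α ⁻¹) β γ
        (code-injective f (α ⁻¹ ∙ β) (α ⁻¹ ∙ γ) (cong₂ _,_ i≡ (trans fixβ (sym fixγ))))))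
    where
    eαγ  = trans eαβ eβγ
    fixβ = ⁻¹∙-fixes α β eαβ
    fixγ = ⁻¹∙-fixes α γ eαγ

  -- A point of the code is determined by its arguments, and any two argument tuples are connected
  -- through `o`.
  base-transitive⇒actsTransitively : (∀ v → ∃[ α ] base f α ≡ v) → ActsTransitively f
  base-transitive⇒actsTransitively reach (x₀ ∷ x , ex) (y₀ ∷ y , ey) = β ∙ α ⁻¹ ,
    cong₂ _∷_ (trans (cong (proj₁ (β ∙ α ⁻¹) zero ⟨$⟩ʳ_) ex)
      (trans (sym (op-act f (β ∙ α ⁻¹) x)) (trans (cong (op f) x↦y) (sym ey)))) x↦y
    where
    α = proj₁ (reach x)
    β = proj₁ (reach y)
    x↦y : act (proj₁ (β ∙ α ⁻¹) ∘ suc) x ≡ y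
    x↦y = begin
      act (proj₁ (β ∙ α ⁻¹) ∘ suc) x             ≡⟨ act-∘ (proj₁ β ∘ suc) (proj₁ (α ⁻¹) ∘ suc) x ⟩
      act (proj₁ β ∘ suc) (act (proj₁ (α ⁻¹) ∘ suc) x)
        ≡⟨ cong (act (proj₁ β ∘ suc) ∘ act (proj₁ (α ⁻¹) ∘ suc)) (sym (proj₂ (reach x))) ⟩
      act (proj₁ β ∘ suc) (act (proj₁ (α ⁻¹) ∘ suc) (base f α))
        ≡⟨ cong (act (proj₁ β ∘ suc)) (act-inverse (proj₁ (α ⁻¹) ∘ suc) o) ⟩
      base f β                                   ≡⟨ proj₂ (reach y) ⟩
      y                                          ∎
      where open ≡-Reasoning

  actsTransitively⇒base-transitive : ActsTransitively f → ∀ v → ∃[ α ] base f α ≡ v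
  actsTransitively⇒base-transitive trans-f v =
    let α , e = trans-f (op f o ∷ o , refl) (op f v ∷ v , refl) in α , cong tail e

module _ {n m} (f : Quasigroup (suc n)) (nonlinear : Nonlinear f) (H : HasOrder (Atp f) m) where

  private
    module H = Inverse H
    p : Fin m → Vec Σ₄ (suc n)
    p = base f ∘ H.from
    _≟ⱽ_ = ≡-dec {n = suc n} (_≟_ {4})

  rank-base : Fin m → Fin 2 × Vec Σ₄ (suc n)
  rank-base i = rank _≟ⱽ_ p i , p i

  -- Three autotopies over one base point would make `f` affine, hence linear, so the fibres of
  -- `base` have at most two elements.
  rank-base-injective : Injective _≡_ _≡_ rank-base
  rank-base-injective = rank-injective _≟ⱽ_ p λ {i} {j} {k} i<j j<k ij jk →
    nonlinear (affine⇒linear f (same-base⇒affine f (H.from i) (H.from j) (H.from k) ij jk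
      (<⇒≢ i<j ∘ from-injective f H i j) (<⇒≢ j<k ∘ from-injective f H j k)
      (<⇒≢ (<-trans i<j j<k) ∘ from-injective f H i k)))

  nonlinear-order≤ : m ≤ 2 * 4 ^ suc n
  nonlinear-order≤ = injective⇒≤ {f = Inverse.to (code↔ 2 (suc n)) ∘ rank-base}
    (rank-base-injective ∘ ↔-injective (code↔ 2 (suc n)))

  -- Rank 1 means that an earlier autotopy fixes `o` too. The two differ, so at least one of them
  -- has a nontrivial index.
  repeated⇒semilinear : ∀ i → rank _≟ⱽ_ p i ≡ 1F → p i ≡ o → Semilinear f
  repeated⇒semilinear i r≡1 pi≡o with rank≡1 _≟ⱽ_ p i r≡1
  ... | j , j<i , e with index f (H.from i) ≟ 0F
  ... | no i≢0 = stabiliser⇒semilinear f nonlinear (H.from i) pi≡o i≢0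
  ... | yes i≡0 = stabiliser⇒semilinear f nonlinear (H.from j) (trans e pi≡o) λ j≡0 →
    <⇒≢ j<i (from-injective f H j i (code-injective f (H.from j) (H.from i)
      (cong₂ _,_ (trans j≡0 (sym i≡0)) e)))

-- At equality `rank-base` is onto. Hitting `(1F , o)` yields a second stabiliser of `o`, and
-- hitting every `(0F , v)` yields transitivity.
maximal⇒semilinear-transitive : (f : Quasigroup (suc n)) → Nonlinear f → HasOrder (Atp f) (2 * 4 ^ suc n) →
  Semilinear f × ActsTransitively f
maximal⇒semilinear-transitive {n} f nonlinear H =
  (let i , e = hit (1F , o) in repeated⇒semilinear f nonlinear H i (cong proj₁ e) (cong proj₂ e)) ,
  base-transitive⇒actsTransitively f λ v → let i , e = hit (0F , v) in Inverse.from H i , cong proj₂ e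
  where
  hit : ∀ c → ∃[ i ] rank-base f nonlinear H i ≡ c
  hit c = let i , e = injective⇒surjective {f = Inverse.to (code↔ 2 (suc n)) ∘ rank-base f nonlinear H}
                        (rank-base-injective f nonlinear H ∘ ↔-injective (code↔ 2 (suc n)))
                        (Inverse.to (code↔ 2 (suc n)) c)
          in i , ↔-injective (code↔ 2 (suc n)) e

-- Transitivity supplies one autotopy over each `v`; applying the nontrivial stabiliser `τ` before
-- it gives another one over the same `v`.
semilinear-transitive⇒order≥ : (f : Quasigroup n) → Semilinear f → ActsTransitively f →
  HasOrder (Atp f) m → 2 * 4 ^ n ≤ m
semilinear-transitive⇒order≥ {n} {m} f (a , b , via) transitive H =
  injective⇒≤ {f = H.to ∘ element ∘ Inverse.from C} (↔-injective (↔-sym C) ∘ element-injective)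
  where
  open Group (Atp f) using (_∙_; ε) renaming (_≈_ to _≋_; trans to ≋-trans; sym to ≋-sym)
  module H = Inverse H
  C = code↔ 2 n
  stab = semilinear⇒stabiliser f a b via
  τ = proj₁ stab
  reach = actsTransitively⇒base-transitive f transitive
  τ≉ε : ¬ τ ≋ ε
  τ≉ε e = ⊕-nonzero (a zero) (b zero) (proj₁ via zero) (transp-injective _ 0F
    (trans (sym (proj₂ (proj₂ stab))) (trans (cong proj₁ (code-cong f τ ε e)) (cong proj₁ (code-ε f)))))
  element : Fin 2 × Vec Σ₄ n → Autotopy f
  element (0F , v) = proj₁ (reach v)
  element (1F , v) = proj₁ (reach v) ∙ τ
  base-element : ∀ c → base f (element c) ≡ proj₂ c
  base-element (0F , v) = proj₂ (reach v)
  base-element (1F , v) = trans (base-∙ f (proj₁ (reach v)) τ (proj₁ (proj₂ stab))) (proj₂ (reach v))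
  to-injective : ∀ α β → H.to α ≡ H.to β → α ≋ β
  to-injective α β e = ≋-trans {α} {H.from (H.to β)} {β}
    (≋-sym {H.from (H.to β)} {α} (H.inverseʳ {α} (sym e))) (H.strictlyInverseʳ β)
  moved : ∀ v → ¬ element (0F , v) ≋ element (1F , v)
  moved v e = τ≉ε (∙-cancelˡ (Atp f) (proj₁ (reach v)) τ ε (≋-sym {proj₁ (reach v)} {proj₁ (reach v) ∙ τ} e))
  same-rank : ∀ k l v → element (k , v) ≋ element (l , v) → k ≡ l
  same-rank 0F 0F v e = refl
  same-rank 0F 1F v e = contradiction e (moved v)
  same-rank 1F 0F v e = contradiction (≋-sym {element (1F , v)} {element (0F , v)} e) (moved v)
  same-rank 1F 1F v e = refl
  element-injective : ∀ {c d} → H.to (element c) ≡ H.to (element d) → c ≡ d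
  element-injective {c@(k , v)} {d@(l , w)} e with
    trans (sym (base-element c))
      (trans (cong proj₂ (code-cong f (element c) (element d) (to-injective _ _ e))) (base-element d))
  ... | refl = cong (_, v) (same-rank k l v (to-injective (element c) (element d) e))

nonlinear-bounded : (f : Quasigroup (suc n)) → Nonlinear f → ∃[ m ] HasOrder (Atp f) m × m ≤ 2 * 4 ^ suc n
nonlinear-bounded f nonlinear = let m , H , _ = order≤ f in m , H , nonlinear-order≤ f nonlinear H

semilinear-transitive⇒maximal : (f : Quasigroup (suc n)) → Nonlinear f → Semilinear f × ActsTransitively f →
  HasOrder (Atp f) (2 * 4 ^ suc n)
semilinear-transitive⇒maximal f nonlinear (semilinear , transitive) =
  let m , H , m≤ = nonlinear-bounded f nonlinear
  in subst (HasOrder (Atp f)) (ℕ.≤-antisym m≤ (semilinear-transitive⇒order≥ f semilinear transitive H)) H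

order⇔linear : (f : Quasigroup (suc n)) → HasOrder (Atp f) (6 * 4 ^ suc n) ⇔ Linear f
order⇔linear f = mk⇔
  -- At the maximal order the code `(4F , o)` occurs, which is a 3-cycle in the stabiliser of `o`.
  (λ H → let α , e = order⇒code-surjective f H (4F , o) in
    affine⇒linear f (threeCycle⇒affine f α (cong proj₂ e)
      (subst (ThreeCycle ∘ s₃) (sym (cong proj₁ e)) (from-yes (threeCycle? 4F)))))
  (code-surjective⇒order f ∘ affine⇒code-surjective f ∘ linear⇒affine f)

-- Extremal examples: iterated addition in ℤ₂² and in ℤ₄

latin⇒quasigroup : (g : Vec Σ₄ n → Σ₄) → Latin g → Quasigroup n
latin⇒quasigroup g latin = record
  { op         = g
  ; invertible = λ i x → latin i x , λ y →
      let a , e = injective⇒surjective (latin i x) y in a , λ { refl → e }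
  }

klein : ∀ n → Quasigroup n
klein n = latin⇒quasigroup ⨁ λ i x {a} {b} e → ⊕-injectiveˡ (⨁ (x [ i ]≔ 0F))
  (trans (⊕-comm a _) (trans (sym (⨁-update x i a)) (trans e (trans (⨁-update x i b) (⊕-comm _ b)))))

klein-affine : ∀ n → Affine (klein n)
klein-affine n = 0F , (λ _ → Perm.id) , λ x →
  trans (⊕-comm 0F (⨁ x)) (cong (λ y → ⨁ y ⊕ 0F) (sym (act-id x)))

infixl 6 _⊞_

_⊞_ : Σ₄ → Σ₄ → Σ₄
0F ⊞ b  = b
1F ⊞ 0F = 1F
1F ⊞ 1F = 2F
1F ⊞ 2F = 3F
1F ⊞ 3F = 0F
2F ⊞ 0F = 2F
2F ⊞ 1F = 3F
2F ⊞ 2F = 0F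
2F ⊞ 3F = 1F
3F ⊞ 0F = 3F
3F ⊞ 1F = 0F
3F ⊞ 2F = 1F
3F ⊞ 3F = 2F

⊟_ : Σ₄ → Σ₄
⊟ 0F = 0F
⊟ 1F = 3F
⊟ 2F = 2F
⊟ 3F = 1F

abstract
  ⊞-⊟ : ∀ a c → a ⊞ c ⊞ ⊟ c ≡ a × a ⊞ ⊟ c ⊞ c ≡ a
  ⊞-⊟ = from-yes (all? λ a → all? λ c → (a ⊞ c ⊞ ⊟ c ≟ a) ×-dec (a ⊞ ⊟ c ⊞ c ≟ a))

  ⊞-comm : ∀ a b → a ⊞ b ≡ b ⊞ a
  ⊞-comm = from-yes (all? λ a → all? λ b → a ⊞ b ≟ b ⊞ a)

  ⊞-interchange : ∀ a b c d → a ⊞ b ⊞ (c ⊞ d) ≡ a ⊞ c ⊞ (b ⊞ d)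
  ⊞-interchange = from-yes (all? λ a → all? λ b → all? λ c → all? λ d → a ⊞ b ⊞ (c ⊞ d) ≟ a ⊞ c ⊞ (b ⊞ d))

  -- Distinct `y` and `y′` exhaust the pair {u, v}, which would then be closed under adding 1; but
  -- adding 1 cycles through all four elements.
  no-unit-period : ∀ y y′ u v → y ≢ y′ → Pair u v y → Pair u v y′ → Pair u v (1F ⊞ y) → ¬ Pair u v (1F ⊞ y′)
  no-unit-period = from-yes (all? λ y → all? λ y′ → all? λ u → all? λ v →
    ¬? (y ≟ y′) →-dec (pair? u v y →-dec (pair? u v y′ →-dec (pair? u v (1F ⊞ y) →-dec ¬? (pair? u v (1F ⊞ y′))))))
    where
    pair? : ∀ u v y → Dec (Pair u v y)
    pair? u v y = (u ≟ y) ⊎-dec (v ≟ y)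

⊞-injectiveˡ : ∀ c {a b} → a ⊞ c ≡ b ⊞ c → a ≡ b
⊞-injectiveˡ c {a} {b} e = trans (sym (proj₁ (⊞-⊟ a c))) (trans (cong (_⊞ ⊟ c) e) (proj₁ (⊞-⊟ b c)))

⊞-injectiveʳ : ∀ c {a b} → c ⊞ a ≡ c ⊞ b → a ≡ b
⊞-injectiveʳ c {a} {b} e = ⊞-injectiveˡ c (trans (⊞-comm a c) (trans e (⊞-comm c b)))

sum₄ : Vec Σ₄ n → Σ₄
sum₄ = foldr′ _⊞_ 0F

sum₄-latin : Latin (sum₄ {n})
sum₄-latin zero    (_ ∷ x) e = ⊞-injectiveˡ (sum₄ x) e
sum₄-latin (suc i) (b ∷ x) e = sum₄-latin i x (⊞-injectiveʳ b e)

cyclic : ∀ n → Quasigroup n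
cyclic n = latin⇒quasigroup sum₄ sum₄-latin

cyclic-transitive : ∀ n → ActsTransitively (cyclic n)
cyclic-transitive n = base-transitive⇒actsTransitively (cyclic n) λ v →
  (translation v , homotopy⇒isAutotopy (cyclic n) (translation v) (sum-translation v)) ,
  trans (tabulate-cong λ i → cong (_⊞ lookup v i) (lookup-replicate i 0F)) (tabulate∘lookup v)
  where
  translate : Σ₄ → Permutation′ 4
  translate c = permutation (_⊞ c) (_⊞ ⊟ c) (λ a → proj₂ (⊞-⊟ a c)) (λ a → proj₁ (⊞-⊟ a c))
  translation : Vec Σ₄ n → Fin (suc n) → Permutation′ 4
  translation v zero    = translate (sum₄ v)
  translation v (suc i) = translate (lookup v i)
  sum-translation : ∀ {n} (v x : Vec Σ₄ n) → sum₄ (act (translate ∘ lookup v) x) ≡ sum₄ x ⊞ sum₄ v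
  sum-translation []      []      = refl
  sum-translation (b ∷ v) (a ∷ x) = trans (cong (a ⊞ b ⊞_) (sum-translation v x))
    (⊞-interchange a b (sum₄ x) (sum₄ v))

-- The witness is the subgroup {0, 2} of ℤ₄, used in every argument.
cyclic-semilinear : ∀ n → Semilinear (cyclic (suc n))
cyclic-semilinear n = (λ _ → 0F) , (λ _ → 2F) , (λ _ ()) , (λ { (x , box , refl) → into x box }) , λ {y} → onto y
  where
  even : ∀ {a b} → Pair 0F 2F a → Pair 0F 2F b → Pair 0F 2F (a ⊞ b)
  even (inj₁ refl) q           = q
  even (inj₂ refl) (inj₁ refl) = inj₂ refl
  even (inj₂ refl) (inj₂ refl) = inj₁ refl
  into : ∀ {n} (x : Vec Σ₄ n) → Box (λ _ → Pair 0F 2F) x → Pair 0F 2F (sum₄ x)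
  into []      box = inj₁ refl
  into (a ∷ x) box = even (box zero) (into x (box ∘ suc))
  sum₄-o : ∀ n → sum₄ (o {n}) ≡ 0F
  sum₄-o zero    = refl
  sum₄-o (suc n) = sum₄-o n
  onto : ∀ y → Pair 0F 2F y → Image sum₄ (Box {suc n} (λ _ → Pair 0F 2F)) y
  onto y (inj₁ q) = o , (λ i → inj₁ (sym (lookup-replicate i 0F))) , trans (sum₄-o n) q
  onto y (inj₂ q) = 2F ∷ o , (λ { zero → inj₂ refl ; (suc i) → inj₁ (sym (lookup-replicate i 0F)) }) ,
    trans (cong (2F ⊞_) (sum₄-o n)) q

cyclic-nonlinear : ∀ n → Nonlinear (cyclic (suc (suc n)))
cyclic-nonlinear n linear with linear (suc zero) 0F 1F (λ ())
... | a , b , (a≢b , image , _) , a₁≡0 , b₁≡1 =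
  -- All arguments after the second are frozen, with sum `s`. Passing the first one from 0 to 1 adds
  -- 1 to both values, and all four results must lie in the image pair.
  no-unit-period (a₂ ⊞ s) (b₂ ⊞ s) (a zero) (b zero) (a≢b (suc (suc zero)) ∘ ⊞-injectiveˡ s)
    (value 0F a₂ (inj₁ a₁≡0) (inj₁ refl)) (value 0F b₂ (inj₁ a₁≡0) (inj₂ refl))
    (value 1F a₂ (inj₂ b₁≡1) (inj₁ refl)) (value 1F b₂ (inj₂ b₁≡1) (inj₂ refl))
  where
  a₂ = a (suc (suc zero))
  b₂ = b (suc (suc zero))
  r = tabulate (λ i → a (suc (suc (suc i))))
  s = sum₄ r
  value : ∀ p q → Pair (a (suc zero)) (b (suc zero)) p → Pair a₂ b₂ q → Pair (a zero) (b zero) (p ⊞ (q ⊞ s))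
  value p q p∈ q∈ = image (p ∷ q ∷ r ,
    (λ { zero → p∈ ; (suc zero) → q∈ ; (suc (suc i)) → inj₁ (sym (lookup∘tabulate _ i)) }) , refl)

theorem4 : (∀ (n : ℕ) → 1 ≤ n →
    IsMaxAtpOrder {n} U (6 * 4 ^ n) ×
    (∀ (f : Quasigroup n) → HasOrder (Atp f) (6 * 4 ^ n) ⇔ Linear f))
    ×
    (∀ (n : ℕ) → 2 ≤ n →
    IsMaxAtpOrder {n} Nonlinear (2 * 4 ^ n) ×
    (∀ (f : Quasigroup n) → Nonlinear f →
    HasOrder (Atp f) (2 * 4 ^ n) ⇔ (Semilinear f × ActsTransitively f)))
theorem4 =
  (λ { (suc n) _ →
       record
         { attained = klein (suc n) , _ , code-surjective⇒order (klein (suc n))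
             (affine⇒code-surjective (klein (suc n)) (klein-affine (suc n)))
         ; bounded  = λ f _ → order≤ f
         } ,
       order⇔linear }) ,
  -- A unary quasigroup is a permutation and hence linear, so nonlinear examples start at arity two.
  (λ { (suc (suc n)) _ →
       record
         { attained = cyclic (suc (suc n)) , cyclic-nonlinear n ,
             semilinear-transitive⇒maximal (cyclic (suc (suc n))) (cyclic-nonlinear n)
               (cyclic-semilinear (suc n) , cyclic-transitive (suc (suc n)))
         ; bounded  = nonlinear-bounded
         } ,
       λ f nonlinear → mk⇔ (maximal⇒semilinear-transitive f nonlinear)
         (semilinear-transitive⇒maximal f nonlinear)
     ; (suc zero) (s≤s ()) })
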